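{- Mean-payoff games can be reduced to average-energy games in polynomial time: there is a polynomial-time computable map which sends each triple $(G,s_{\mathrm{init}},t)$ consisting of a game, an initial state and a threshold $t\in\mathbb{Q}$ to a triple $(G',s'_{\mathrm{init}},t')$ of the same kind such that player 1 has a winning strategy from $s_{\mathrm{init}}$ in $G$ for the mean-payoff objective $\mathsf{MeanPayoff}(t)$ if and only if player 1 has a winning strategy from $s'_{\mathrm{init}}$ in $G'$ for the average-energy objective $\mathsf{AvgEnergy}(t')$.
   Context: A game is a tuple $G=(S_1,S_2,E,w)$ where $S_1,S_2$ are disjoint finite sets of states belonging to player 1 and player 2, $S=S_1\uplus S_2$, $E\subseteq S\times S$ is a finite set of edges such that every state has at least one outgoing edge, and $w\colon E\to\mathbb{Z}$ is an integer weight function. A play from $s_{\mathrm{init}}$ is an infinite sequence $\pi=s_0s_1s_2\dots$ with $s_0=s_{\mathrm{init}}$ and $(s_i,s_{i+1})\in E$ for all $i\ge 0$; $\pi(n)=s_0\dots s_n$ is its prefix up to position $n$. A strategy for player $i$ is a function mapping each finite prefix ending in a state of $S_i$ to a successor (along an edge) of its last state. Strategies of the two players and $s_{\mathrm{init}}$ determine a unique play, the outcome. The energy level is $\mathrm{EL}(\pi(n))=\sum_{i=0}^{n-1}w(s_i,s_{i+1})$; the mean-payoff of $\pi$ is $\overline{MP}(\pi)=\limsup_{n\to\infty}\frac1n\mathrm{EL}(\pi(n))$; the average-energy of $\pi$ is $\overline{AE}(\pi)=\limsup_{n\to\infty}\frac1n\sum_{i=1}^{n}\mathrm{EL}(\pi(i))$.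 For $t\in\mathbb{Q}$, $\mathsf{MeanPayoff}(t)$ is the set of plays with $\overline{MP}(\pi)\le t$ and $\mathsf{AvgEnergy}(t)$ is the set of plays with $\overline{AE}(\pi)\le t$. A strategy of player 1 is winning from $s_{\mathrm{init}}$ for an objective $\mathcal W$ (a set of plays) if, for every strategy of player 2, the outcome lies in $\mathcal W$. Weights and thresholds are encoded in binary. -}

module Defs where

open import Data.Bool.Base using (Bool; true; false; T)
open import Data.Fin.Base using (Fin; zero; suc; toℕ)
open import Data.Integer.Base as ℤ using (ℤ; 0ℤ; +_; -[1+_])
open import Data.List.Base using (List; []; _∷_; _++_; map; concatMap; allFin; length; replicate)
open import Data.Maybe.Base using (Maybe; just; nothing)
open import Data.Nat.Base as ℕ using (ℕ; zero; suc)
open import Data.Nat.Binary.Base using (ℕᵇ; zero; 2[1+_]; 1+[2_]; fromℕ)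
open import Data.Product.Base using (Σ; ∃; ∃-syntax; _×_; _,_; proj₁; proj₂)
open import Data.Rational.Base as ℚ using (ℚ; ↥_; ↧ₙ_)
open import Data.Unit.Base using (tt)
open import Data.Vec.Base as Vec using (Vec; _∷_)
open import Relation.Binary.PropositionalEquality.Core using (_≡_; refl)

------------------------------------------------------------------------
-- Games

data Player : Set where
  player₁ player₂ : Player

-- The states are Fin size, and the owner function is the partition S = S₁ ⊎ S₂.

record Game : Set where
  field
    size  : ℕ

  State : Set
  State = Fin size

  field
    owner : State → Player
    E     : State → State → Bool
    w     : ∀ {s s′} → T (E s s′) → ℤ
    total : ∀ s → ∃[ s′ ] T (E s s′)

module _ (G : Game) where
  open Game G

  infixl 5 _▸_

  -- Prefix s₀ s: finite prefixes of plays from s₀ whose last state is s.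

  data Prefix (s₀ : State) : State → Set where
    start : Prefix s₀ s₀
    _▸_   : ∀ {s s′} → Prefix s₀ s → T (E s s′) → Prefix s₀ s′

  Successor : State → Set
  Successor s = ∃[ s′ ] T (E s s′)

  Strategy : Player → State → Set
  Strategy i s₀ = ∀ {s} → Prefix s₀ s → owner s ≡ i → Successor s

  record Play (s₀ : State) : Set where
    field
      state   : ℕ → State
      initial : state 0 ≡ s₀
      edge    : ∀ i → T (E (state i) (state (suc i)))

module _ {G : Game} {s₀ : Game.State G}
         (σ : Strategy G player₁ s₀) (τ : Strategy G player₂ s₀) where
  open Game G

  next : ∀ {s} → Prefix G s₀ s → Successor G s
  next {s} h = choose (owner s) refl
    where
    choose : ∀ i → owner s ≡ i → Successor G s
    choose player₁ p = σ h p
    choose player₂ p = τ h p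

  history : ℕ → ∃[ s ] Prefix G s₀ s
  history zero    = s₀ , start
  history (suc n) = proj₁ (next h) , h ▸ proj₂ (next h)
    where h = proj₂ (history n)

  outcome : Play G s₀
  outcome = record
    { state   = λ n → proj₁ (history n)
    ; initial = refl
    ; edge    = λ n → proj₂ (next (proj₂ (history n)))
    }

------------------------------------------------------------------------
-- Limit superior

-- An extended real x is given by its upper cut { q ∈ ℚ ∣ x < q }.

UpperReal : Set₁
UpperReal = ℚ → Set

infix 4 _≤ᵘ_

_≤ᵘ_ : UpperReal → ℚ → Set
x ≤ᵘ t = ∀ q → t ℚ.< q → x q

-- sup { a n ∣ n ≥ N }

tailSup : (ℕ → ℚ) → ℕ → UpperReal
tailSup a N q = ∃[ r ] r ℚ.< q × (∀ n → N ℕ.≤ n → a n ℚ.≤ r)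

-- The infimum over N of tailSup a N: cuts of infima are unions.

limsup : (ℕ → ℚ) → UpperReal
limsup a q = ∃[ N ] tailSup a N q

------------------------------------------------------------------------
-- Objectives

module _ {G : Game} {s₀ : Game.State G} (π : Play G s₀) where
  open Game G
  open Play π

  EL : ℕ → ℤ
  EL zero    = 0ℤ
  EL (suc n) = EL n ℤ.+ w (edge n)

  -- EL 1 + … + EL n

  sumEL : ℕ → ℤ
  sumEL zero    = 0ℤ
  sumEL (suc n) = sumEL n ℤ.+ EL (suc n)

  -- The sequences 1/n · EL n and 1/n · sumEL n are taken at n = 1, 2, ….

  meanPayoff : UpperReal
  meanPayoff = limsup λ m → EL (suc m) ℚ./ suc m

  averageEnergy : UpperReal
  averageEnergy = limsup λ m → sumEL (suc m) ℚ./ suc m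

Objective : Set₁
Objective = ∀ {G s₀} → Play G s₀ → Set

MeanPayoff AvgEnergy : ℚ → Objective
MeanPayoff t π = meanPayoff π ≤ᵘ t
AvgEnergy  t π = averageEnergy π ≤ᵘ t

Winning : ∀ {G s₀} → Objective → Strategy G player₁ s₀ → Set
Winning {G} {s₀} W σ = (τ : Strategy G player₂ s₀) → W (outcome σ τ)

record Instance : Set where
  field
    game      : Game
    init      : Game.State game
    threshold : ℚ

Player₁Wins : (ℚ → Objective) → Instance → Set
Player₁Wins W I = Σ (Strategy game player₁ init) λ σ → Winning (W threshold) σ
  where open Instance I

------------------------------------------------------------------------
-- Encoding of instances as words

data Symbol : Set where
  one two     : Symbol  -- binary digits
  pos neg     : Symbol  -- signs
  absent      : Symbol  -- no edge
  own₁ own₂   : Symbol  -- owners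
  tick        : Symbol  -- unary digit
  sep         : Symbol  -- separator

Word : Set
Word = List Symbol

-- The binary numerals of the library use the digits 1 and 2; the least
-- significant digit comes first and 0 is the empty numeral.

encodeℕᵇ : ℕᵇ → Word
encodeℕᵇ zero     = []
encodeℕᵇ 1+[2 x ] = one ∷ encodeℕᵇ x
encodeℕᵇ 2[1+ x ] = two ∷ encodeℕᵇ x

encodeℕ : ℕ → Word
encodeℕ n = encodeℕᵇ (fromℕ n)

encodeℤ : ℤ → Word
encodeℤ (+ n)    = pos ∷ encodeℕ n
encodeℤ -[1+ n ] = neg ∷ encodeℕ (suc n)

encodeℚ : ℚ → Word
encodeℚ t = encodeℤ (↥ t) ++ sep ∷ encodeℕ (↧ₙ t)

encodeOwner : Player → Symbol
encodeOwner player₁ = own₁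
encodeOwner player₂ = own₂

encodeEntry : (b : Bool) → (T b → ℤ) → Word
encodeEntry true  w = encodeℤ (w tt)
encodeEntry false w = absent ∷ []

-- A game is written as its weighted adjacency matrix, each row preceded by
-- the owner of the state.

encodeGame : Game → Word
encodeGame G = concatMap row (allFin size)
  where
  open Game G

  row : State → Word
  row s = encodeOwner (owner s) ∷ concatMap (λ s′ → encodeEntry (E s s′) w) (allFin size)

encode : Instance → Word
encode I = encodeGame game ++ sep ∷ replicate (toℕ init) tick ++ sep ∷ encodeℚ threshold
  where open Instance I

------------------------------------------------------------------------
-- Deterministic multi-tape Turing machines

-- A cell holds a symbol or is blank (nothing).

Cell : Set
Cell = Maybe Symbol

-- A two-way infinite tape: the cells to the left of the head (nearest first),
-- the scanned cell, and the cells to the right.  Unlisted cells are blank.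

record Tape : Set where
  constructor tape
  field
    left  : List Cell
    head  : Cell
    right : List Cell

blankTape : Tape
blankTape = tape [] nothing []

load : Word → Tape
load []       = blankTape
load (x ∷ xs) = tape [] (just x) (map just xs)

-- The longest blank-free word starting at the head.

contents : Tape → Word
contents (tape _ h r) = readCells (h ∷ r)
  where
  readCells : List Cell → Word
  readCells []             = []
  readCells (nothing ∷ _)  = []
  readCells (just x  ∷ cs) = x ∷ readCells cs

data Move : Set where
  goLeft stay goRight : Move

write : Cell → Tape → Tape
write c (tape l _ r) = tape l c r

move : Move → Tape → Tape
move stay    t                  = t
move goLeft  (tape []      h r) = tape [] nothing (h ∷ r)
move goLeft  (tape (c ∷ l) h r) = tape l c (h ∷ r)
move goRight (tape l h [])      = tape (h ∷ l) nothing []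
move goRight (tape l h (c ∷ r)) = tape (h ∷ l) c r

act : Cell × Move → Tape → Tape
act (c , m) t = move m (write c t)

-- Tape 0 holds the input, tape 1 the output.  The machine halts when no
-- transition applies.

record TuringMachine : Set where
  field
    workTapes : ℕ
    states    : ℕ

  tapes : ℕ
  tapes = 2 ℕ.+ workTapes

  field
    initialState : Fin states
    δ : Fin states → Vec Cell tapes → Maybe (Fin states × Vec (Cell × Move) tapes)

module _ (M : TuringMachine) where
  open TuringMachine M

  Configuration : Set
  Configuration = Fin states × Vec Tape tapes

  initialConfiguration : Word → Configuration
  initialConfiguration x = initialState , load x ∷ Vec.replicate _ blankTape

  step : Configuration → Maybe Configuration
  step (q , ts) with δ q (Vec.map Tape.head ts)
  ... | nothing        = nothing
  ... | just (q′ , as) = just (q′ , Vec.zipWith act as ts)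

  outputWord : Configuration → Word
  outputWord (_ , ts) = contents (Vec.lookup ts (suc zero))

  -- From c, M halts after exactly n steps with output y.

  data HaltsIn : (n : ℕ) (c : Configuration) (y : Word) → Set where
    halted : ∀ {c y} → step c ≡ nothing → outputWord c ≡ y → HaltsIn 0 c y
    later  : ∀ {n c c′ y} → step c ≡ just c′ → HaltsIn n c′ y → HaltsIn (suc n) c y

-- Every polynomial over ℕ is bounded by one of the form c · n ^ d + c.

record PolynomialTime {A B : Set} (encodeA : A → Word) (encodeB : B → Word)
                      (f : A → B) : Set where
  field
    machine : TuringMachine
    c d     : ℕ
    runs    : ∀ x → ∃[ n ]
                n ℕ.≤ c ℕ.* length (encodeA x) ℕ.^ d ℕ.+ c
                × HaltsIn machine n (initialConfiguration machine (encodeA x)) (encodeB (f x))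

{-# OPTIONS --safe #-}
module Submission where

-- Every edge of weight w is split into two consecutive edges of weights 2w and
-- −2w.  The energy level of the new game is then 0 at every even position and
-- twice the weight of an edge at every odd one, so the average-energy over 2n
-- steps is the mean-payoff over n steps; strategies are transferred along the
-- bijection between plays.
--
-- The new game has n + n² states, the n² pairs (a , b) being the midpoints.  A
-- third tape, the template, has one cell per state; a single mark on it tells in
-- which column the next entry has to be printed.  With digits 1 and 2 doubling is
-- a transduction: leading ones become twos and the first two becomes 2, 1.

open import Defs
open import Algebra.Properties.CommutativeSemigroup using (x∙yz≈y∙xz)
open import Axiom.UniquenessOfIdentityProofs.WithK using (uip)
open import Data.Bool.Base using (Bool; true; false; T; if_then_else_; _∨_)
open import Data.Bool.Properties using (T-irrelevant; if-float; ∨-conicalˡ; ∨-conicalʳ)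
open import Data.Fin.Base using (Fin; zero; suc; toℕ; _↑ˡ_; _↑ʳ_; splitAt; combine; remQuot; join)
open import Data.Fin.Properties
  using (_≟_; splitAt-↑ˡ; splitAt-↑ʳ; join-splitAt; combine-remQuot; remQuot-combine; toℕ-↑ˡ)
open import Data.Integer.Base as ℤ using (ℤ; 0ℤ; +_; -[1+_]; +≤+; -≤+; ∣_∣)
import Data.Integer.Properties as ℤ
import Data.Integer.Solver as ℤSolver
open import Data.List.Base
  using (List; []; _∷_; _++_; _ʳ++_; length; map; concat; concatMap; replicate; tabulate; allFin)
open import Data.List.Properties
  using (++-assoc; ++-identityʳ; ++-ʳ++; ʳ++-ʳ++; length-++; length-++-≤ˡ; length-++-≤ʳ; length-map;
         length-replicate; length-tabulate; length-ʳ++; map-tabulate; tabulate-cong)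
open import Data.List.Relation.Unary.All as All using (All; []; _∷_)
import Data.List.Relation.Unary.All.Properties as All
open import Data.Maybe.Base as Maybe using (Maybe; just; nothing; maybe; is-just)
open import Data.Nat.Base as ℕ using (ℕ; zero; suc; _+_; _*_; _^_; _≤_; z≤n; s≤s)
open import Data.Nat.Binary.Base as ℕᵇ using (ℕᵇ; fromℕ; 2[1+_]; 1+[2_])
import Data.Nat.Binary.Properties as ℕᵇ
open import Data.Nat.Properties hiding (_≟_)
import Data.Nat.Properties as ℕ
open import Data.Product using (Σ; ∃-syntax; _×_; _,_; proj₁; proj₂; map₁)
open import Data.Rational.Base as ℚ using (↥_; ↧_; ↧ₙ_; mkℚ; *<*)
import Data.Rational.Properties as ℚ
open import Data.Rational.Unnormalised.Base as ℚᵘ using (mkℚᵘ)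
import Data.Rational.Unnormalised.Properties as ℚᵘ
open import Data.Sum.Base as Sum using (_⊎_; inj₁; inj₂; [_,_]′)
open import Data.Unit.Base using (tt)
open import Data.Vec.Base as Vec using (Vec; []; _∷_; lookup)
open import Data.Vec.Properties using (lookup-zipWith)
open import Function.Base using (_∘_; const)
open import Function.Bundles using (_⇔_; mk⇔; module Equivalence)
open import Relation.Binary.PropositionalEquality
open import Relation.Nullary using (does; yes; no; contradiction)

-- Structured programs for Turing machines

-- In a play whose mean-payoff is not 0 the energy level drifts off, and the average-energy with it.
-- Paying every weight back at once stops the drift: per original step, the sum of the levels grows
-- by twice the weight. The factor 2 makes up for the doubled number of steps, so the threshold
-- stays the same and its encoding is merely copied. There is a midpoint for every pair of states,
-- not only for every edge. The place of an entry in the new matrix then depends on its row and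
-- column alone, and the machine has nothing to look up. A finite control cannot count up to n + n²
-- columns; all counting is unary, on the template.

module Programs (k : ℕ) where

  Heads Actions Tapes : Set
  Heads   = Vec Cell k
  Actions = Vec (Cell × Move) k
  Tapes   = Vec Tape k

  heads : Tapes → Heads
  heads = Vec.map Tape.head

  idle : Heads → Actions
  idle = Vec.map (_, stay)

  infixr 5 _⨾_

  data Program : Set where
    perform : (Heads → Actions) → Program
    _⨾_     : Program → Program → Program
    while   : (Heads → Bool) → Program → Program

  -- Run L p ts us: the program p turns ts into us, and each of its loops is
  -- iterated at most L times whenever it is entered.

  data Run (L : ℕ) : Program → Tapes → Tapes → Set
  data Loop (L : ℕ) (c : Heads → Bool) (p : Program) : ℕ → Tapes → Tapes → Set

  data Run L where
    perform : ∀ {f ts us} → Vec.zipWith act (f (heads ts)) ts ≡ us → Run L (perform f) ts us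
    _⨾_     : ∀ {p q ts us vs} → Run L p ts us → Run L q us vs → Run L (p ⨾ q) ts vs
    while   : ∀ {c p m ts us} → m ≤ L → Loop L c p m ts us → Run L (while c p) ts us

  data Loop L c p where
    done : ∀ {ts} → c (heads ts) ≡ false → Loop L c p 0 ts ts
    iter : ∀ {m ts us vs} → c (heads ts) ≡ true → Run L p ts us → Loop L c p m us vs →
           Loop L c p (suc m) ts vs

  -- One bound `L` for all loops makes this a polynomial in `L` whose degree is the nesting depth of
  -- the loops. The outer `suc` pays for the final failing test.
  cost : Program → ℕ → ℕ
  cost (perform _) L = 1
  cost (p ⨾ q)     L = cost p L + cost q L
  cost (while _ p) L = suc (L * suc (cost p L))

  #locations : Program → ℕ
  #locations (perform _) = 1
  #locations (p ⨾ q)     = #locations p + #locations q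
  #locations (while _ p) = suc (#locations p)

  entry : ∀ p → Fin (#locations p)
  entry (perform _) = zero
  entry (p ⨾ q)     = entry p ↑ˡ #locations q
  entry (while _ p) = zero

  -- The location nothing is the exit of the program.

  transition : ∀ p → Fin (#locations p) → Heads → Maybe (Fin (#locations p)) × Actions
  transition (perform f) _ h = nothing , f h
  transition (p ⨾ q) l h =
    [ (λ l₁ → map₁ (just ∘ maybe (_↑ˡ #locations q) (#locations p ↑ʳ entry q)) (transition p l₁ h))
    , (λ l₂ → map₁ (Maybe.map (#locations p ↑ʳ_)) (transition q l₂ h))
    ]′ (splitAt (#locations p) l)
  transition (while c p) zero    h = (if c h then just (suc (entry p)) else nothing) , idle h
  transition (while c p) (suc l) h = map₁ (just ∘ maybe suc zero) (transition p l h)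

  data Exits (p : Program) : ℕ → Fin (#locations p) → Tapes → Tapes → Set where
    exit : ∀ {l ts as us} → transition p l (heads ts) ≡ (nothing , as) →
           Vec.zipWith act as ts ≡ us → Exits p 1 l ts us
    goto : ∀ {n l l′ ts as us} → transition p l (heads ts) ≡ (just l′ , as) →
           Exits p n l′ (Vec.zipWith act as ts) us → Exits p (suc n) l ts us

  exits-⨾ʳ : ∀ {p q n l ts us} → Exits q n l ts us → Exits (p ⨾ q) n (#locations p ↑ʳ l) ts us
  exits-⨾ʳ {p} {q} {l = l} (exit e r) = exit e′ r
    where e′ = trans (cong [ _ , _ ]′ (splitAt-↑ʳ (#locations p) (#locations q) l))
                     (cong (map₁ (Maybe.map (#locations p ↑ʳ_))) e)
  exits-⨾ʳ {p} {q} {l = l} (goto e r) = goto e′ (exits-⨾ʳ r)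
    where e′ = trans (cong [ _ , _ ]′ (splitAt-↑ʳ (#locations p) (#locations q) l))
                     (cong (map₁ (Maybe.map (#locations p ↑ʳ_))) e)

  -- The transition that leaves `p` already leads to the entry of `q`, so composition costs no
  -- additional step.
  exits-⨾ : ∀ {p q m n l ts us vs} → Exits p m l ts us → Exits q n (entry q) us vs →
            Exits (p ⨾ q) (m + n) (l ↑ˡ #locations q) ts vs
  exits-⨾ {p} {q} {l = l} (exit e refl) s = goto e′ (exits-⨾ʳ s)
    where e′ = trans (cong [ _ , _ ]′ (splitAt-↑ˡ (#locations p) l (#locations q)))
                     (cong (map₁ (just ∘ maybe (_↑ˡ #locations q) (#locations p ↑ʳ entry q))) e)
  exits-⨾ {p} {q} {l = l} (goto e r) s = goto e′ (exits-⨾ r s)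
    where e′ = trans (cong [ _ , _ ]′ (splitAt-↑ˡ (#locations p) l (#locations q)))
                     (cong (map₁ (just ∘ maybe (_↑ˡ #locations q) (#locations p ↑ʳ entry q))) e)

  exits-body : ∀ {c p m n l ts us vs} → Exits p m l ts us → Exits (while c p) n zero us vs →
               Exits (while c p) (m + n) (suc l) ts vs
  exits-body (exit e refl) s = goto (cong (map₁ (just ∘ maybe suc zero)) e) s
  exits-body (goto e r)    s = goto (cong (map₁ (just ∘ maybe suc zero)) e) (exits-body r s)

  act-idle : ∀ {n} (ts : Vec Tape n) →
             Vec.zipWith act (Vec.map (_, stay) (Vec.map Tape.head ts)) ts ≡ ts
  act-idle []       = refl
  act-idle (t ∷ ts) = cong (t ∷_) (act-idle ts)

  run⇒exits  : ∀ {L p ts us} → Run L p ts us → ∃[ n ] n ≤ cost p L × Exits p n (entry p) ts us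
  loop⇒exits : ∀ {L c p m ts us} → Loop L c p m ts us →
               ∃[ n ] n ≤ suc (m * suc (cost p L)) × Exits (while c p) n zero ts us

  run⇒exits (perform e) = 1 , ≤-refl , exit refl e
  run⇒exits (r ⨾ s) =
    let m , m≤ , x = run⇒exits r
        n , n≤ , y = run⇒exits s
    in m + n , +-mono-≤ m≤ n≤ , exits-⨾ x y
  run⇒exits {L} {while c p} (while m≤L l) =
    let n , n≤ , x = loop⇒exits l
    in n , ≤-trans n≤ (s≤s (*-monoˡ-≤ (suc (cost p L)) m≤L)) , x

  loop⇒exits {ts = ts} (done e) =
    1 , s≤s z≤n , exit (cong (λ b → (if b then _ else _) , _) e) (act-idle ts)
  loop⇒exits {L} {c} {p} {suc m} {ts} (iter e r l) =
    let i , i≤ , x = run⇒exits r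
        j , j≤ , y = loop⇒exits l
    in suc (i + j)
     , s≤s (≤-trans (+-mono-≤ i≤ j≤) (≤-reflexive (+-suc (cost p L) (m * suc (cost p L)))))
     , goto (cong (λ b → (if b then _ else _) , _) e)
            (subst (λ us → Exits (while c p) (i + j) (suc (entry p)) us _) (sym (act-idle ts))
              (exits-body x y))

  length-left-move : ∀ a t → length (Tape.left (act a t)) ≤ suc (length (Tape.left t))
  length-left-move (_ , stay)    t                  = n≤1+n _
  length-left-move (_ , goLeft)  (tape [] _ _)      = z≤n
  length-left-move (_ , goLeft)  (tape (_ ∷ l) _ _) = ≤-trans (n≤1+n _) (n≤1+n _)
  length-left-move (_ , goRight) (tape l _ [])      = ≤-refl
  length-left-move (_ , goRight) (tape l _ (_ ∷ _)) = ≤-refl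

  length-left-step : ∀ {n} i (as : Vec (Cell × Move) n) ts →
    length (Tape.left (lookup (Vec.zipWith act as ts) i)) ≤ suc (length (Tape.left (lookup ts i)))
  length-left-step i as ts =
    subst (λ t → length (Tape.left t) ≤ _) (sym (lookup-zipWith act i as ts))
      (length-left-move (lookup as i) (lookup ts i))

  -- At most one cell per step is added to the left of a head. This is what bounds the length of the
  -- output by the running time.
  length-left : ∀ {p n l ts us} i → Exits p n l ts us →
                length (Tape.left (lookup us i)) ≤ length (Tape.left (lookup ts i)) + n
  length-left {ts = ts} i (exit {as = as} _ refl) =
    ≤-trans (length-left-step i as ts) (≤-reflexive (+-comm 1 _))
  length-left {ts = ts} i (goto {n} {as = as} _ r) =
    ≤-trans (length-left i r)
      (≤-trans (+-monoˡ-≤ n (length-left-step i as ts)) (≤-reflexive (sym (+-suc _ n))))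

-- Compilation of programs to Turing machines.

module _ {w : ℕ} where
  open Programs (2 + w)

  compile : Program → TuringMachine
  compile p = record
    { workTapes    = w
    ; states       = suc (#locations p)
    ; initialState = suc (entry p)
    ; δ            = λ where
        -- State `zero` is the exit of the program and the only state in which the machine halts.
        zero    h → nothing
        (suc l) h → just (map₁ (maybe suc zero) (transition p l h))
    }

  exits⇒halts : ∀ {p n l ts us y} → Exits p n l ts us → contents (lookup us (suc zero)) ≡ y →
                HaltsIn (compile p) n (suc l , ts) y
  exits⇒halts {p} (exit {ts = ts} e refl) o =
    later (cong (λ r → just (maybe suc zero (proj₁ r) , Vec.zipWith act (proj₂ r) ts)) e)
          (halted refl o)
  exits⇒halts {p} (goto {ts = ts} e r) o =
    later (cong (λ r → just (maybe suc zero (proj₁ r) , Vec.zipWith act (proj₂ r) ts)) e)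
          (exits⇒halts r o)

-- Powers of 1 + n rather than of n: they are monotone in the exponent even at n = 0.

Polynomial : (ℕ → ℕ) → Set
Polynomial f = ∃[ c ] ∃[ d ] ∀ n → f n ≤ c * suc n ^ d

polynomial-const : ∀ k → Polynomial λ _ → k
polynomial-const k = k , 0 , λ n → ≤-reflexive (sym (*-identityʳ k))

polynomial-id : Polynomial λ n → n
polynomial-id = 1 , 1 , λ n →
  ≤-trans (n≤1+n n) (≤-reflexive (sym (trans (*-identityˡ _) (*-identityʳ (suc n)))))

polynomial-+ : ∀ {f g} → Polynomial f → Polynomial g → Polynomial λ n → f n + g n
polynomial-+ {f} {g} (c , d , f≤) (c′ , d′ , g≤) = c + c′ , d + d′ , λ n → begin
  f n + g n                                       ≤⟨ +-mono-≤ (f≤ n) (g≤ n) ⟩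
  c * suc n ^ d + c′ * suc n ^ d′                 ≤⟨ +-mono-≤ (*-monoʳ-≤ c (^-monoʳ-≤ (suc n) (m≤m+n d d′)))
                                                              (*-monoʳ-≤ c′ (^-monoʳ-≤ (suc n) (m≤n+m d′ d))) ⟩
  c * suc n ^ (d + d′) + c′ * suc n ^ (d + d′)    ≡⟨ *-distribʳ-+ _ c c′ ⟨
  (c + c′) * suc n ^ (d + d′)                     ∎
  where open ≤-Reasoning

polynomial-* : ∀ {f g} → Polynomial f → Polynomial g → Polynomial λ n → f n * g n
polynomial-* {f} {g} (c , d , f≤) (c′ , d′ , g≤) = c * c′ , d + d′ , λ n → begin
  f n * g n                              ≤⟨ *-mono-≤ (f≤ n) (g≤ n) ⟩
  c * suc n ^ d * (c′ * suc n ^ d′)      ≡⟨ [m*n]*[o*p]≡[m*o]*[n*p] c _ c′ _ ⟩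
  c * c′ * (suc n ^ d * suc n ^ d′)      ≡⟨ cong (c * c′ *_) (^-distribˡ-+-* (suc n) d d′) ⟨
  c * c′ * suc n ^ (d + d′)              ∎
  where open ≤-Reasoning

^-distribʳ-* : ∀ m n d → (m * n) ^ d ≡ m ^ d * n ^ d
^-distribʳ-* m n zero    = refl
^-distribʳ-* m n (suc d) =
  trans (cong (m * n *_) (^-distribʳ-* m n d)) ([m*n]*[o*p]≡[m*o]*[n*p] m n (m ^ d) (n ^ d))

-- For positive `n` the first summand suffices, as 1 + n ≤ 2n; the second one covers `n` = 0, where
-- `n ^ d` vanishes for every positive `d`.
suc-^≤ : ∀ n d → suc n ^ d ≤ 2 ^ d * n ^ d + 2 ^ d
suc-^≤ zero    d = ≤-trans (≤-reflexive (^-zeroˡ d)) (≤-trans (m^n>0 2 d) (m≤n+m (2 ^ d) _))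
suc-^≤ (suc n) d = begin
  suc (suc n) ^ d                 ≤⟨ ^-monoˡ-≤ d (2+n≤2*1+n n) ⟩
  (2 * suc n) ^ d                 ≡⟨ ^-distribʳ-* 2 (suc n) d ⟩
  2 ^ d * suc n ^ d               ≤⟨ m≤m+n _ (2 ^ d) ⟩
  2 ^ d * suc n ^ d + 2 ^ d       ∎
  where
  open ≤-Reasoning

  2+n≤2*1+n : ∀ n → suc (suc n) ≤ 2 * suc n
  2+n≤2*1+n n = s≤s (≤-trans (m≤m+n (suc n) n) (≤-reflexive (sym (begin-equality
    n + (suc n + 0)   ≡⟨ cong (λ m → n + m) (+-identityʳ (suc n)) ⟩
    n + suc n         ≡⟨ +-suc n n ⟩
    suc (n + n)       ∎))))

polynomial-bound : ∀ {f} → Polynomial f → ∃[ c ] ∃[ d ] ∀ n → f n ≤ c * n ^ d + c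
polynomial-bound {f} (c , d , f≤) = c * 2 ^ d , d , λ n → begin
  f n                                ≤⟨ f≤ n ⟩
  c * suc n ^ d                      ≤⟨ *-monoʳ-≤ c (suc-^≤ n d) ⟩
  c * (2 ^ d * n ^ d + 2 ^ d)        ≡⟨ *-distribˡ-+ c _ _ ⟩
  c * (2 ^ d * n ^ d) + c * 2 ^ d    ≡⟨ cong (_+ c * 2 ^ d) (*-assoc c (2 ^ d) (n ^ d)) ⟨
  c * 2 ^ d * n ^ d + c * 2 ^ d      ∎
  where open ≤-Reasoning

module _ {k : ℕ} where
  open Programs k

  polynomial-cost : ∀ p {f} → Polynomial f → Polynomial λ n → cost p (f n)
  polynomial-cost (perform _) P = polynomial-const 1
  polynomial-cost (p ⨾ q)     P = polynomial-+ (polynomial-cost p P) (polynomial-cost q P)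
  polynomial-cost (while _ p) P =
    polynomial-+ (polynomial-const 1)
      (polynomial-* P (polynomial-+ (polynomial-const 1) (polynomial-cost p P)))

-- The reduction as a program on three tapes

open Programs 3

-- Tapes whose used part is delimited by blanks on both sides; ls is reversed.

cells : Word → List Cell
cells w = map just w ++ nothing ∷ []

headOf : Word → Cell
headOf []      = nothing
headOf (x ∷ _) = just x

tailOf : Word → List Cell
tailOf []      = []
tailOf (_ ∷ w) = cells w

at : Word → Word → Tape
at ls rs = tape (cells ls) (headOf rs) (tailOf rs)

right-at : ∀ x ls rs → move goRight (tape (cells ls) (just x) (cells rs)) ≡ at (x ∷ ls) rs
right-at x ls []      = refl
right-at x ls (_ ∷ _) = refl

tapes≡ : {t t′ u u′ v v′ : Tape} → t ≡ t′ → u ≡ u′ → v ≡ v′ →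
         _≡_ {A = Tapes} (t ∷ u ∷ v ∷ []) (t′ ∷ u′ ∷ v′ ∷ [])
tapes≡ refl refl refl = refl

-- Moving and rewinding a single tape.

moveAt : Fin 3 → Move → Heads → Actions
moveAt i m h = Vec.updateAt (idle h) i λ (c , _) → c , m

-- The head may start on the blank behind the word, where the loop would stop immediately; hence the
-- unconditional first move.
rewind : Fin 3 → Program
rewind i = perform (moveAt i goLeft)
         ⨾ while (λ h → is-just (lookup h i)) (perform (moveAt i goLeft))
         ⨾ perform (moveAt i goRight)

-- `C` is a vector of tapes with a hole at position `i`. One proof then serves all three tapes, and
-- at each of them both hypotheses hold by `refl`.
module _ (i : Fin 3) (C : Tape → Tapes)
         (reads : ∀ t → lookup (heads (C t)) i ≡ Tape.head t)
         (moves : ∀ m t → Vec.zipWith act (moveAt i m (heads (C t))) (C t) ≡ C (move m t)) where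

  offLeft : Word → Tape
  offLeft w = tape [] nothing (cells w)

  rewind-step : ∀ x ls rs → move goLeft (at (x ∷ ls) rs) ≡ at ls (x ∷ rs)
  rewind-step x ls []      = refl
  rewind-step x ls (_ ∷ _) = refl

  rewind-loop : ∀ {L} x ls rs → Loop L (λ h → is-just (lookup h i)) (perform (moveAt i goLeft))
                (suc (length ls)) (C (at ls (x ∷ rs))) (C (offLeft (ls ʳ++ x ∷ rs)))
  rewind-loop x []       rs = iter (cong is-just (reads _)) (perform (moves goLeft _)) (done (cong is-just (reads _)))
  rewind-loop x (y ∷ ls) rs =
    iter (cong is-just (reads _))
         (perform (trans (moves goLeft _) (cong C (rewind-step y ls (x ∷ rs)))))
         (rewind-loop y ls (x ∷ rs))

  rewind-onto : ∀ {L} ls rs → length ls ≤ L → Run L (rewind i) (C (at ls rs)) (C (at [] (ls ʳ++ rs)))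
  rewind-onto ls rs len = perform (moves goLeft _) ⨾ middle ls rs len
    where
    off : ∀ rs → move goLeft (at [] rs) ≡ offLeft rs
    off []      = refl
    off (_ ∷ _) = refl

    on : ∀ rs → move goRight (offLeft rs) ≡ at [] rs
    on []      = refl
    on (_ ∷ _) = refl

    middle : ∀ {L} ls rs → length ls ≤ L →
             Run L (while (λ h → is-just (lookup h i)) (perform (moveAt i goLeft)) ⨾ perform (moveAt i goRight))
               (C (move goLeft (at ls rs))) (C (at [] (ls ʳ++ rs)))
    middle [] rs len rewrite off rs =
      while z≤n (done (cong is-just (reads _))) ⨾ perform (trans (moves goRight _) (cong C (on rs)))
    middle (x ∷ ls) rs len rewrite rewind-step x ls rs =
      while len (rewind-loop x ls rs) ⨾ perform (trans (moves goRight _) (cong C (on (ls ʳ++ x ∷ rs))))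

  rewind-over : ∀ {L} w rs → length w ≤ L → Run L (rewind i) (C (at (w ʳ++ []) rs)) (C (at [] (w ++ rs)))
  rewind-over {L} w rs len =
    subst (λ v → Run L (rewind i) (C (at (w ʳ++ []) rs)) (C (at [] v))) (ʳ++-ʳ++ w)
      (rewind-onto (w ʳ++ []) rs
        (≤-trans (≤-reflexive (trans (length-ʳ++ w) (+-identityʳ (length w)))) len))

rewind-input : ∀ {L o t} w rs → length w ≤ L →
  Run L (rewind zero) (at (w ʳ++ []) rs ∷ o ∷ t ∷ []) (at [] (w ++ rs) ∷ o ∷ t ∷ [])
rewind-input {o = o} {t} = rewind-over zero (λ i → i ∷ o ∷ t ∷ []) (λ _ → refl) (λ _ _ → refl)

rewind-output : ∀ {L i t} w rs → length w ≤ L →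
  Run L (rewind (suc zero)) (i ∷ at (w ʳ++ []) rs ∷ t ∷ []) (i ∷ at [] (w ++ rs) ∷ t ∷ [])
rewind-output {i = i} {t} = rewind-over (suc zero) (λ o → i ∷ o ∷ t ∷ []) (λ _ → refl) (λ _ _ → refl)

rewind-template : ∀ {L i o} w rs → length w ≤ L →
  Run L (rewind (suc (suc zero))) (i ∷ o ∷ at (w ʳ++ []) rs ∷ []) (i ∷ o ∷ at [] (w ++ rs) ∷ [])
rewind-template {i = i} {o} = rewind-over (suc (suc zero)) (λ t → i ∷ o ∷ t ∷ []) (λ _ → refl) (λ _ _ → refl)

-- Transductions of numerals and matrix entries.

isOne isTwo isDigit isAbsent isOwner isEntry isGame : Cell → Bool
isOne (just one) = true
isOne _          = false
isTwo (just two) = true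
isTwo _          = false
isDigit c = isOne c ∨ isTwo c
isAbsent (just absent) = true
isAbsent _             = false
isOwner (just own₁) = true
isOwner (just own₂) = true
isOwner _           = false
isEntry (just pos)    = true
isEntry (just neg)    = true
isEntry (just absent) = true
isEntry _             = false
isGame c = isDigit c ∨ isOwner c ∨ isEntry c

input template : Heads → Cell
input    (i ∷ _ ∷ _ ∷ []) = i
template (_ ∷ _ ∷ t ∷ []) = t

when : (Heads → Bool) → (Heads → Actions) → Program
when c f = perform λ h → if c h then f h else idle h

skip : ∀ {L} c f ts → c (heads ts) ≡ false → Run L (when c f) ts ts
skip c f ts e = perform (trans (cong (λ b → Vec.zipWith act (if b then _ else _) ts) e) (act-idle ts))

copy : Heads → Actions
copy (i ∷ o ∷ t ∷ []) = (i , goRight) ∷ (i , goRight) ∷ (t , stay) ∷ []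

print : Symbol → Move → Heads → Actions
print x m (i ∷ o ∷ t ∷ []) = (i , m) ∷ (just x , goRight) ∷ (t , stay) ∷ []

-- With the least significant digit first, twice 1 + 2x is 2(1 + 2x): digit two, then the digits of
-- 2x, so the doubling goes on. Twice 2(1 + x) is 2(1 + (1 + 2x)): digits two and one, then `x`
-- itself, so the rest is copied. The first `when` stays on the scanned two, which lets the second
-- one fire as well; a numeral of ones only triggers neither.
doubleDigits : Program
doubleDigits = while (isOne ∘ input) (perform (print two goRight))
             ⨾ when (isTwo ∘ input) (print two stay)
             ⨾ when (isTwo ∘ input) (print one goRight)
             ⨾ while (isDigit ∘ input) (perform copy)

isDigit-digits : ∀ x {r} → x ≢ ℕᵇ.zero → isDigit (headOf (encodeℕᵇ x ++ r)) ≡ true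
isDigit-digits ℕᵇ.zero  nz = contradiction refl nz
isDigit-digits 2[1+ x ] nz = refl
isDigit-digits 1+[2 x ] nz = refl

copyDigits-loop : ∀ {L} x {ls r os t} → isDigit (headOf r) ≡ false →
  Loop L (isDigit ∘ input) (perform copy) (length (encodeℕᵇ x))
    (at ls (encodeℕᵇ x ++ r) ∷ at os [] ∷ t ∷ [])
    (at (encodeℕᵇ x ʳ++ ls) r ∷ at (encodeℕᵇ x ʳ++ os) [] ∷ t ∷ [])
copyDigits-loop ℕᵇ.zero  end = done end
copyDigits-loop 2[1+ x ] end = iter refl (perform (tapes≡ (right-at two _ _) refl refl)) (copyDigits-loop x end)
copyDigits-loop 1+[2 x ] end = iter refl (perform (tapes≡ (right-at one _ _) refl refl)) (copyDigits-loop x end)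

-- A numeral has no delimiter of its own; the hypothesis on `r` tells where it ends.
doubleDigits-run : ∀ {L} x ls {r} os {t} → isDigit (headOf r) ≡ false → length (encodeℕᵇ x) ≤ L →
  Run L doubleDigits
    (at ls (encodeℕᵇ x ++ r) ∷ at os [] ∷ t ∷ [])
    (at (encodeℕᵇ x ʳ++ ls) r ∷ at (encodeℕᵇ (ℕᵇ.double x) ʳ++ os) [] ∷ t ∷ [])
doubleDigits-run {L} x ls os end len = let m , us , m≤ , l , r = go x end len in while (≤-trans m≤ len) l ⨾ r
  where
  -- The run is cut behind the leading ones. Where that is depends on `x`, so the number `m` of
  -- iterations and the tapes `us` reached are existential.
  go : ∀ x {ls r os t} → isDigit (headOf r) ≡ false → length (encodeℕᵇ x) ≤ L →
    ∃[ m ] ∃[ us ] m ≤ length (encodeℕᵇ x)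
      × Loop L (isOne ∘ input) (perform (print two goRight)) m (at ls (encodeℕᵇ x ++ r) ∷ at os [] ∷ t ∷ []) us
      × Run L (when (isTwo ∘ input) (print two stay) ⨾ when (isTwo ∘ input) (print one goRight)
               ⨾ while (isDigit ∘ input) (perform copy)) us
          (at (encodeℕᵇ x ʳ++ ls) r ∷ at (encodeℕᵇ (ℕᵇ.double x) ʳ++ os) [] ∷ t ∷ [])
  go ℕᵇ.zero {r = r} end len =
    0 , _ , z≤n , done (∨-conicalˡ (isOne (headOf r)) _ end) ,
    skip (isTwo ∘ input) (print two stay) _ e ⨾ skip (isTwo ∘ input) (print one goRight) _ e ⨾ while z≤n (done end)
    where e = ∨-conicalʳ (isOne (headOf r)) _ end
  go 2[1+ x ] end len =
    0 , _ , z≤n , done refl ,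
    perform refl ⨾ perform (tapes≡ (right-at two _ _) refl refl)
    ⨾ while (≤-trans (n≤1+n _) len) (copyDigits-loop x end)
  go 1+[2 x ] end len =
    let m , us , m≤ , l , r = go x end (≤-trans (n≤1+n _) len)
    in suc m , us , s≤s m≤ , iter refl (perform (tapes≡ (right-at one _ _) refl refl)) l , r

Entry : Set
Entry = Maybe ℤ

encodeEntry′ : Entry → Word
encodeEntry′ nothing  = absent ∷ []
encodeEntry′ (just z) = encodeℤ z

doubled : Entry → Entry
doubled = Maybe.map λ z → z ℤ.+ z

-- The midpoint of a non-edge cannot be entered, but `total` demands a successor of it; its edge
-- gets the weight 0.
returning : Entry → ℤ
returning nothing  = 0ℤ
returning (just z) = ℤ.- (z ℤ.+ z)

encodeℕ-double : ∀ n → encodeℕᵇ (ℕᵇ.double (fromℕ n)) ≡ encodeℕ (n + n)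
encodeℕ-double n = cong encodeℕᵇ (ℕᵇ.toℕ-injective (begin
  ℕᵇ.toℕ (ℕᵇ.double (fromℕ n))   ≡⟨ ℕᵇ.toℕ-double (fromℕ n) ⟩
  2 * ℕᵇ.toℕ (fromℕ n)           ≡⟨ cong (2 *_) (ℕᵇ.toℕ-fromℕ n) ⟩
  n + (n + 0)                    ≡⟨ cong (λ m → n + m) (+-identityʳ n) ⟩
  n + n                          ≡⟨ ℕᵇ.toℕ-fromℕ (n + n) ⟨
  ℕᵇ.toℕ (fromℕ (n + n))         ∎))
  where open ≡-Reasoning

-- `absent` is treated as a sign followed by the empty numeral, so no case distinction is needed.
doubleEntry : Program
doubleEntry = perform copy ⨾ doubleDigits

-- The default case turns `absent` into the sign of 0. The output head waits on the new sign,
-- because only the next input symbol shows whether any digits follow: 0 has the sign `pos`, also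
-- after negation.
flipSign : Heads → Actions
flipSign (i ∷ o ∷ t ∷ []) = (i , goRight) ∷ (flip i , stay) ∷ (t , stay) ∷ []
  where
  flip : Cell → Cell
  flip (just pos) = just neg
  flip _          = just pos

-- Corrects the sign of 0.

fixSign : Heads → Actions
fixSign (i ∷ o ∷ t ∷ []) = (i , stay) ∷ ((if isDigit i then o else just pos) , goRight) ∷ (t , stay) ∷ []

returnEntry : Program
returnEntry = perform flipSign ⨾ perform fixSign ⨾ doubleDigits

doubleEntry-run : ∀ {L} e ls {r} os {t} → isDigit (headOf r) ≡ false → length (encodeEntry′ e) ≤ L →
  Run L doubleEntry
    (at ls (encodeEntry′ e ++ r) ∷ at os [] ∷ t ∷ [])
    (at (encodeEntry′ e ʳ++ ls) r ∷ at (encodeEntry′ (doubled e) ʳ++ os) [] ∷ t ∷ [])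
doubleEntry-run nothing ls os end len =
  perform (tapes≡ (right-at absent ls _) refl refl)
  ⨾ doubleDigits-run ℕᵇ.zero (absent ∷ ls) (absent ∷ os) end z≤n
doubleEntry-run (just (+ n)) ls os end len rewrite sym (encodeℕ-double n) =
  perform (tapes≡ (right-at pos ls _) refl refl)
  ⨾ doubleDigits-run (fromℕ n) (pos ∷ ls) (pos ∷ os) end (≤-trans (n≤1+n _) len)
doubleEntry-run (just -[1+ n ]) ls os end len
  rewrite sym (trans (encodeℕ-double (suc n)) (cong (encodeℕ ∘ suc) (+-suc n n))) =
  perform (tapes≡ (right-at neg ls _) refl refl)
  ⨾ doubleDigits-run (fromℕ (suc n)) (neg ∷ ls) (neg ∷ os) end (≤-trans (n≤1+n _) len)

isDigit-suc : ∀ n {r} → isDigit (headOf (encodeℕ (suc n) ++ r)) ≡ true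
isDigit-suc n = isDigit-digits (fromℕ (suc n)) λ e →
  0≢1+n (trans (cong ℕᵇ.toℕ (sym e)) (ℕᵇ.toℕ-fromℕ (suc n)))

fixSign-run : ∀ {L} x b ls rs os {t} → isDigit (headOf rs) ≡ b →
  Run L (perform fixSign)
    (at ls rs ∷ tape (cells os) (just x) [] ∷ t ∷ [])
    (at ls rs ∷ at ((if b then x else pos) ∷ os) [] ∷ t ∷ [])
fixSign-run x b ls rs os refl = perform (tapes≡ refl (lemma (isDigit (headOf rs))) refl)
  where
  lemma : ∀ b → act ((if b then just x else just pos) , goRight) (tape (cells os) (just x) [])
              ≡ at ((if b then x else pos) ∷ os) []
  lemma true  = refl
  lemma false = refl

returnEntry-run : ∀ {L} e ls {r} os {t} → isDigit (headOf r) ≡ false → length (encodeEntry′ e) ≤ L →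
  Run L returnEntry
    (at ls (encodeEntry′ e ++ r) ∷ at os [] ∷ t ∷ [])
    (at (encodeEntry′ e ʳ++ ls) r ∷ at (encodeℤ (returning e) ʳ++ os) [] ∷ t ∷ [])
returnEntry-run nothing ls {r} os end len =
  perform (tapes≡ (right-at absent ls _) refl refl)
  ⨾ fixSign-run pos false (absent ∷ ls) r os end
  ⨾ doubleDigits-run ℕᵇ.zero (absent ∷ ls) (pos ∷ os) end z≤n
returnEntry-run (just (+ zero)) ls {r} os end len =
  perform (tapes≡ (right-at pos ls _) refl refl)
  ⨾ fixSign-run neg false (pos ∷ ls) r os end
  ⨾ doubleDigits-run ℕᵇ.zero (pos ∷ ls) (pos ∷ os) end z≤n
returnEntry-run (just (+ suc n)) ls {r} os end len rewrite sym (encodeℕ-double (suc n)) =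
  perform (tapes≡ (right-at pos ls _) refl refl)
  ⨾ fixSign-run neg true (pos ∷ ls) (encodeℕ (suc n) ++ r) os (isDigit-suc n)
  ⨾ doubleDigits-run (fromℕ (suc n)) (pos ∷ ls) (neg ∷ os) end (≤-trans (n≤1+n _) len)
returnEntry-run (just -[1+ n ]) ls {r} os end len
  rewrite sym (trans (encodeℕ-double (suc n)) (cong (encodeℕ ∘ suc) (+-suc n n))) =
  perform (tapes≡ (right-at neg ls _) refl refl)
  ⨾ fixSign-run pos true (neg ∷ ls) (encodeℕ (suc n) ++ r) os (isDigit-suc n)
  ⨾ doubleDigits-run (fromℕ (suc n)) (neg ∷ ls) (pos ∷ os) end (≤-trans (n≤1+n _) len)

-- Delimiting the words, building the template, placing the mark.

ending : ∀ {L p ts us vs} → us ≡ vs → Run L p ts us → Run L p ts vs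
ending refl r = r

-- `load` lists no blanks, whereas `at` has one on either side of the word. Visiting a cell makes it
-- listed: one move left and a sweep to the right end delimit the input, one move right suffices on
-- the two empty tapes.
normalise : Program
normalise = perform (λ { (i ∷ o ∷ t ∷ []) → (i , goLeft) ∷ (o , goRight) ∷ (t , goRight) ∷ [] })
          ⨾ perform (moveAt zero goRight)
          ⨾ while (is-just ∘ input) (perform (moveAt zero goRight))
          ⨾ rewind zero

raw : Word → Word → Tape
raw ls []       = tape (cells ls) nothing []
raw ls (x ∷ rs) = tape (cells ls) (just x) (map just rs)

normalise-run : ∀ {L} w → length w ≤ L →
  Run L normalise (load w ∷ blankTape ∷ blankTape ∷ []) (at [] w ∷ at [] [] ∷ at [] [] ∷ [])
normalise-run {L} w len =
  perform refl ⨾ perform (tapes≡ (enter w) refl refl) ⨾ while len (sweep w)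
  ⨾ ending (tapes≡ (cong (at []) (++-identityʳ w)) refl refl) (rewind-input w [] len)
  where
  enter : ∀ w → move goRight (move goLeft (write (Tape.head (load w)) (load w))) ≡ raw [] w
  enter []      = refl
  enter (_ ∷ _) = refl

  right-raw : ∀ x ls rs → move goRight (raw ls (x ∷ rs)) ≡ raw (x ∷ ls) rs
  right-raw x ls []      = refl
  right-raw x ls (_ ∷ _) = refl

  sweep : ∀ rs {ls o t} → Loop L (is-just ∘ input) (perform (moveAt zero goRight)) (length rs)
                            (raw ls rs ∷ o ∷ t ∷ []) (at (rs ʳ++ ls) [] ∷ o ∷ t ∷ [])
  sweep []            = done refl
  sweep (x ∷ rs) {ls} = iter refl (perform (tapes≡ (right-raw x ls rs) refl refl)) (sweep rs)

absents : ℕ → Word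
absents n = replicate n absent

absents-+ : ∀ m n → absents (m + n) ≡ absents m ++ absents n
absents-+ zero    n = refl
absents-+ (suc m) n = cong (absent ∷_) (absents-+ m n)

mark : Word → Word
mark []      = []
mark (_ ∷ w) = tick ∷ w

length-mark : ∀ w → length (mark w) ≡ length w
length-mark []      = refl
length-mark (_ ∷ _) = refl

isMark : Cell → Bool
isMark c = isOwner c ∨ isEntry c

count : (Cell → Bool) → Word → ℕ
count p []      = 0
count p (x ∷ w) = if p (just x) then suc (count p w) else count p w

count-++ : ∀ p v w → count p (v ++ w) ≡ count p v + count p w
count-++ p []      w = refl
count-++ p (x ∷ v) w with p (just x)
... | true  = cong suc (count-++ p v w)
... | false = count-++ p v w

count≤length : ∀ p w → count p w ≤ length w
count≤length p []      = z≤n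
count≤length p (x ∷ w) with p (just x)
... | true  = s≤s (count≤length p w)
... | false = m≤n⇒m≤1+n (count≤length p w)

GameSymbol : Symbol → Set
GameSymbol x = isGame (just x) ≡ true

appendColumn nextColumn : Heads → Actions
appendColumn (i ∷ o ∷ t ∷ []) =
  (i , goRight) ∷ (o , stay) ∷ (if isMark i then (just absent , goRight) else (t , stay)) ∷ []
nextColumn (i ∷ o ∷ t ∷ []) =
  (i , goRight) ∷ (o , stay) ∷ (if isOwner i then (t , goRight) else (t , stay)) ∷ []

-- A blank is left alone: behind the last column the mark is dropped, and the template never grows.
overwrite : Symbol → Heads → Actions
overwrite x (i ∷ o ∷ t ∷ []) = (i , stay) ∷ (o , stay) ∷ (Maybe.map (const x) t , stay) ∷ []

-- One template cell per owner and per entry gives n + n² cells for n states, the width of the new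
-- matrix. The mark is put behind the first n cells, on the column of the first midpoint.
measure locate : Program
measure = while (isGame ∘ input) (perform appendColumn)
        ⨾ rewind zero ⨾ rewind (suc (suc zero))
locate  = while (isGame ∘ input) (perform nextColumn)
        ⨾ perform (overwrite tick) ⨾ rewind zero ⨾ rewind (suc (suc zero))

measure-loop : ∀ {L} g ls ts {z o} → All GameSymbol g →
  Loop L (isGame ∘ input) (perform appendColumn) (length g)
    (at ls (g ++ sep ∷ z) ∷ o ∷ at ts [] ∷ [])
    (at (g ʳ++ ls) (sep ∷ z) ∷ o ∷ at (absents (count isMark g) ʳ++ ts) [] ∷ [])
measure-loop []                ls ts []         = done refl
measure-loop {L} (x ∷ g) ls ts {z} {o} (gx ∷ gs) = by (isMark (just x)) refl
  where
  c = count isMark g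

  by : ∀ b → isMark (just x) ≡ b →
       Loop L (isGame ∘ input) (perform appendColumn) (suc (length g))
         (at ls (x ∷ g ++ sep ∷ z) ∷ o ∷ at ts [] ∷ [])
         (at (g ʳ++ x ∷ ls) (sep ∷ z) ∷ o ∷ at (absents (if b then suc c else c) ʳ++ ts) [] ∷ [])
  by true  eq = iter gx (perform (tapes≡ (right-at x ls _) refl
    (cong (λ b → act (if b then (just absent , goRight) else (nothing , stay)) (at ts [])) eq)))
    (measure-loop g (x ∷ ls) (absent ∷ ts) gs)
  by false eq = iter gx (perform (tapes≡ (right-at x ls _) refl
    (cong (λ b → act (if b then (just absent , goRight) else (nothing , stay)) (at ts [])) eq)))
    (measure-loop g (x ∷ ls) ts gs)

measure-run : ∀ {L} g {z o} → All GameSymbol g → length g ≤ L →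
  Run L measure
    (at [] (g ++ sep ∷ z) ∷ o ∷ at [] [] ∷ [])
    (at [] (g ++ sep ∷ z) ∷ o ∷ at [] (absents (count isMark g)) ∷ [])
measure-run {L} g {z} gs len =
  while len (measure-loop g [] [] gs) ⨾ rewind-input g _ len
  ⨾ ending (tapes≡ refl refl (cong (at []) (++-identityʳ _)))
      (rewind-template (absents (count isMark g)) []
        (≤-trans (≤-reflexive (length-replicate _)) (≤-trans (count≤length isMark g) len)))

locate-loop : ∀ {L} g ls ts v {z o} → All GameSymbol g →
  Loop L (isGame ∘ input) (perform nextColumn) (length g)
    (at ls (g ++ sep ∷ z) ∷ o ∷ at ts (absents (count isOwner g) ++ v) ∷ [])
    (at (g ʳ++ ls) (sep ∷ z) ∷ o ∷ at (absents (count isOwner g) ʳ++ ts) v ∷ [])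
locate-loop []                ls ts v []         = done refl
locate-loop {L} (x ∷ g) ls ts v {z} {o} (gx ∷ gs) = by (isOwner (just x)) refl
  where
  c = count isOwner g

  column : Bool → Word → Tape
  column b w = act (if b then (headOf w , goRight) else (headOf w , stay)) (at ts w)

  by : ∀ b → isOwner (just x) ≡ b →
       Loop L (isGame ∘ input) (perform nextColumn) (suc (length g))
         (at ls (x ∷ g ++ sep ∷ z) ∷ o ∷ at ts (absents (if b then suc c else c) ++ v) ∷ [])
         (at (g ʳ++ x ∷ ls) (sep ∷ z) ∷ o ∷ at (absents (if b then suc c else c) ʳ++ ts) v ∷ [])
  by true  eq = iter gx (perform (tapes≡ (right-at x ls _) refl
    (trans (cong (λ b → column b (absents (suc c) ++ v)) eq) (right-at absent ts (absents c ++ v)))))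
    (locate-loop g (x ∷ ls) (absent ∷ ts) v gs)
  by false eq = iter gx (perform (tapes≡ (right-at x ls _) refl
    (cong (λ b → column b (absents c ++ v)) eq)))
    (locate-loop g (x ∷ ls) ts v gs)

overwrite-tick : ∀ {L i o} ls w →
  Run L (perform (overwrite tick)) (i ∷ o ∷ at ls w ∷ []) (i ∷ o ∷ at ls (mark w) ∷ [])
overwrite-tick ls []      = perform refl
overwrite-tick ls (_ ∷ _) = perform refl

locate-run : ∀ {L} g v {z o} → All GameSymbol g → length g ≤ L →
  Run L locate
    (at [] (g ++ sep ∷ z) ∷ o ∷ at [] (absents (count isOwner g) ++ v) ∷ [])
    (at [] (g ++ sep ∷ z) ∷ o ∷ at [] (absents (count isOwner g) ++ mark v) ∷ [])
locate-run g v gs len =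
  while len (locate-loop g [] [] v gs) ⨾ overwrite-tick _ v ⨾ rewind-input g _ len
  ⨾ rewind-template (absents (count isOwner g)) (mark v)
      (≤-trans (≤-reflexive (length-replicate _)) (≤-trans (count≤length isOwner g) len))

-- Rows of the input and the words to be printed.

Row : Set
Row = Player × List Entry

encodeEntries : List Entry → Word
encodeEntries = concatMap encodeEntry′

encodeRow : Row → Word
encodeRow (o , es) = encodeOwner o ∷ encodeEntries es

encodeRows : List Row → Word
encodeRows = concatMap encodeRow

entries : List Row → ℕ
entries []                = 0
entries ((_ , es) ∷ rows) = length es + entries rows

-- j is the column of the mark; in secondRow, k is the number of columns of midpoints.

firstRows : ℕ → List Row → Word
firstRows j []                = []
firstRows j ((o , es) ∷ rows) =
  encodeOwner o ∷ absents j ++ encodeEntries (map doubled es) ++ absents (entries rows)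
  ++ firstRows (j + length es) rows

secondRow : ℕ → ℕ → List Entry → Word
secondRow k j []       = []
secondRow k j (e ∷ es) =
  own₁ ∷ absents j ++ encodeℤ (returning e) ++ absents (length es + k) ++ secondRow k (suc j) es

secondRows : ℕ → List Row → Word
secondRows k = concatMap λ (_ , es) → secondRow k 0 es

digits-game : ∀ x → All GameSymbol (encodeℕᵇ x)
digits-game ℕᵇ.zero  = []
digits-game 2[1+ x ] = refl ∷ digits-game x
digits-game 1+[2 x ] = refl ∷ digits-game x

entry-game : ∀ e → All GameSymbol (encodeEntry′ e)
entry-game nothing         = refl ∷ []
entry-game (just (+ n))    = refl ∷ digits-game (fromℕ n)
entry-game (just -[1+ n ]) = refl ∷ digits-game (fromℕ (suc n))

entries-game : ∀ es → All GameSymbol (encodeEntries es)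
entries-game []       = []
entries-game (e ∷ es) = All.++⁺ (entry-game e) (entries-game es)

rows-game : ∀ rows → All GameSymbol (encodeRows rows)
rows-game []                      = []
rows-game ((player₁ , es) ∷ rows) = refl ∷ All.++⁺ (entries-game es) (rows-game rows)
rows-game ((player₂ , es) ∷ rows) = refl ∷ All.++⁺ (entries-game es) (rows-game rows)


owners-digits : ∀ x → count isOwner (encodeℕᵇ x) ≡ 0
owners-digits ℕᵇ.zero  = refl
owners-digits 2[1+ x ] = owners-digits x
owners-digits 1+[2 x ] = owners-digits x

marks-digits : ∀ x → count isMark (encodeℕᵇ x) ≡ 0
marks-digits ℕᵇ.zero  = refl
marks-digits 2[1+ x ] = marks-digits x
marks-digits 1+[2 x ] = marks-digits x

owners-entry : ∀ e → count isOwner (encodeEntry′ e) ≡ 0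
owners-entry nothing         = refl
owners-entry (just (+ n))    = owners-digits (fromℕ n)
owners-entry (just -[1+ n ]) = owners-digits (fromℕ (suc n))

marks-entry : ∀ e → count isMark (encodeEntry′ e) ≡ 1
marks-entry nothing         = refl
marks-entry (just (+ n))    = cong suc (marks-digits (fromℕ n))
marks-entry (just -[1+ n ]) = cong suc (marks-digits (fromℕ (suc n)))

owners-entries : ∀ es → count isOwner (encodeEntries es) ≡ 0
owners-entries []       = refl
owners-entries (e ∷ es) =
  trans (count-++ isOwner (encodeEntry′ e) _) (cong₂ _+_ (owners-entry e) (owners-entries es))

marks-entries : ∀ es → count isMark (encodeEntries es) ≡ length es
marks-entries []       = refl
marks-entries (e ∷ es) =
  trans (count-++ isMark (encodeEntry′ e) _) (cong₂ _+_ (marks-entry e) (marks-entries es))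

owners-row : ∀ r → count isOwner (encodeRow r) ≡ 1
owners-row (player₁ , es) = cong suc (owners-entries es)
owners-row (player₂ , es) = cong suc (owners-entries es)

marks-row : ∀ r → count isMark (encodeRow r) ≡ suc (length (proj₂ r))
marks-row (player₁ , es) = cong suc (marks-entries es)
marks-row (player₂ , es) = cong suc (marks-entries es)

owners-rows : ∀ rows → count isOwner (encodeRows rows) ≡ length rows
owners-rows []         = refl
owners-rows (r ∷ rows) =
  trans (count-++ isOwner (encodeRow r) _) (cong₂ _+_ (owners-row r) (owners-rows rows))

marks-rows : ∀ rows → count isMark (encodeRows rows) ≡ length rows + entries rows
marks-rows []         = refl
marks-rows (r ∷ rows) = begin
  count isMark (encodeRows (r ∷ rows))                        ≡⟨ count-++ isMark (encodeRow r) _ ⟩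
  count isMark (encodeRow r) + count isMark (encodeRows rows) ≡⟨ cong₂ _+_ (marks-row r) (marks-rows rows) ⟩
  suc (m + (length rows + entries rows))                      ≡⟨ cong suc (x∙yz≈y∙xz +-commutativeSemigroup m (length rows) (entries rows)) ⟩
  suc (length rows + (m + entries rows))                      ∎
  where
  open ≡-Reasoning
  m = length (proj₂ r)

-- Printing the rows of the split matrix.

starting : ∀ {L p ts us vs} → ts ≡ us → Run L p us vs → Run L p ts vs
starting refl r = r

printAbsent : Heads → Actions
printAbsent (i ∷ o ∷ t ∷ []) = (i , stay) ∷ (just absent , goRight) ∷ (t , goRight) ∷ []

blanken : Heads → Actions
blanken (i ∷ o ∷ t ∷ []) = (i , stay) ∷ (o , stay) ∷ (just absent , goRight) ∷ []

-- The mark is erased in front of the printed entries and set again behind them, so each row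
-- advances it by the number of entries it holds. `resetTemplate` sends it back to column 0, since
-- for fixed a the midpoints (a , 0), (a , 1), ... return to the columns 0, 1, ....
columnsBefore columnsAfter resetTemplate : Program
columnsBefore = while (isAbsent ∘ template) (perform printAbsent)
              ⨾ perform (overwrite absent)
columnsAfter  = perform (overwrite tick)
              ⨾ while (is-just ∘ template) (perform printAbsent)
              ⨾ rewind (suc (suc zero))
resetTemplate = while (is-just ∘ template) (perform blanken)
              ⨾ rewind (suc (suc zero)) ⨾ perform (overwrite tick)

printFirstRow printSecondRow printFirstRows printSecondRows : Program
printFirstRow = perform copy ⨾ columnsBefore
  ⨾ while (isEntry ∘ input) (doubleEntry ⨾ perform (moveAt (suc (suc zero)) goRight))
  ⨾ columnsAfter
printSecondRow = perform (print own₁ stay) ⨾ columnsBefore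
  ⨾ returnEntry ⨾ perform (moveAt (suc (suc zero)) goRight)
  ⨾ columnsAfter
printFirstRows  = while (isOwner ∘ input) printFirstRow
printSecondRows = while (isOwner ∘ input)
  (perform (moveAt zero goRight) ⨾ resetTemplate ⨾ while (isEntry ∘ input) printSecondRow)

columnsBefore-run : ∀ {L i} os j k → j ≤ L →
  Run L columnsBefore
    (i ∷ at os [] ∷ at [] (absents j ++ mark (absents k)) ∷ [])
    (i ∷ at (absents j ʳ++ os) [] ∷ at (absents j ʳ++ []) (absents k) ∷ [])
columnsBefore-run {L} {i} os j k j≤L = while j≤L (sweep j os []) ⨾ unmark k
  where
  stop : ∀ k → isAbsent (headOf (mark (absents k))) ≡ false
  stop zero    = refl
  stop (suc _) = refl

  sweep : ∀ j os ls → Loop L (isAbsent ∘ template) (perform printAbsent) j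
    (i ∷ at os [] ∷ at ls (absents j ++ mark (absents k)) ∷ [])
    (i ∷ at (absents j ʳ++ os) [] ∷ at (absents j ʳ++ ls) (mark (absents k)) ∷ [])
  sweep zero    os ls = done (stop k)
  sweep (suc j) os ls = iter refl (perform (tapes≡ refl refl (right-at absent ls _)))
                             (sweep j (absent ∷ os) (absent ∷ ls))

  unmark : ∀ k {o ls} → Run L (perform (overwrite absent))
                          (i ∷ o ∷ at ls (mark (absents k)) ∷ []) (i ∷ o ∷ at ls (absents k) ∷ [])
  unmark zero    = perform refl
  unmark (suc _) = perform refl

-- The template head has passed j + a columns.

columnsAfter-run : ∀ {L i} os j a k → j + a + k ≤ L →
  Run L columnsAfter
    (i ∷ at os [] ∷ at (absents a ʳ++ (absents j ʳ++ [])) (absents k) ∷ [])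
    (i ∷ at (absents k ʳ++ os) [] ∷ at [] (absents (j + a) ++ mark (absents k)) ∷ [])
columnsAfter-run {L} {i} os j a k len rewrite sym (++-ʳ++ (absents j) {absents a} {[]}) | sym (absents-+ j a) =
  overwrite-tick passed (absents k)
  ⨾ while (m+n≤o⇒n≤o (j + a) len)
      (sweep (mark (absents k)) os passed marked)
  ⨾ starting (tapes≡ refl refl (cong (λ v → at v []) (sym (++-ʳ++ (absents (j + a)) {mark (absents k)}))))
      (ending (tapes≡ refl refl (cong (at []) (++-identityʳ _)))
        (rewind-template (absents (j + a) ++ mark (absents k)) []
          (≤-trans (≤-reflexive (trans (length-++ (absents (j + a)))
                                       (cong₂ _+_ (length-replicate (j + a)) marked))) len)))
  where
  passed = absents (j + a) ʳ++ []

  marked : length (mark (absents k)) ≡ k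
  marked = trans (length-mark (absents k)) (length-replicate k)

  sweep : ∀ w os ls {m} → length w ≡ m → Loop L (is-just ∘ template) (perform printAbsent) m
    (i ∷ at os [] ∷ at ls w ∷ [])
    (i ∷ at (absents m ʳ++ os) [] ∷ at (w ʳ++ ls) [] ∷ [])
  sweep []      os ls refl = done refl
  sweep (x ∷ w) os ls refl = iter refl (perform (tapes≡ refl refl (right-at x ls _)))
                                  (sweep w (absent ∷ os) (x ∷ ls) refl)

-- Only the length of `w` matters: `printFirstRows` leaves a template without a mark, while an
-- earlier round of `printSecondRows` may leave one behind the columns of the original states.
resetTemplate-run : ∀ {L i o} w → length w ≤ L →
  Run L resetTemplate
    (i ∷ o ∷ at [] w ∷ [])
    (i ∷ o ∷ at [] (mark (absents (length w))) ∷ [])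
resetTemplate-run {L} {i} {o} w len =
  while len (sweep w [])
  ⨾ ending (tapes≡ refl refl (cong (at []) (++-identityʳ _)))
      (rewind-template (absents (length w)) [] (≤-trans (≤-reflexive (length-replicate (length w))) len))
  ⨾ overwrite-tick [] (absents (length w))
  where
  sweep : ∀ w ls → Loop L (is-just ∘ template) (perform blanken) (length w)
    (i ∷ o ∷ at ls w ∷ []) (i ∷ o ∷ at (absents (length w) ʳ++ ls) [] ∷ [])
  sweep []      ls = done refl
  sweep (x ∷ w) ls = iter refl (perform (tapes≡ refl refl (right-at absent ls _))) (sweep w (absent ∷ ls))

isEntry-entry : ∀ e {r} → isEntry (headOf (encodeEntry′ e ++ r)) ≡ true
isEntry-entry nothing         = refl
isEntry-entry (just (+ _))    = refl
isEntry-entry (just -[1+ _ ]) = refl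

isDigit-entry : ∀ e {r} → isDigit (headOf (encodeEntry′ e ++ r)) ≡ false
isDigit-entry nothing         = refl
isDigit-entry (just (+ _))    = refl
isDigit-entry (just -[1+ _ ]) = refl

isDigit-entries : ∀ es {r} → isDigit (headOf r) ≡ false → isDigit (headOf (encodeEntries es ++ r)) ≡ false
isDigit-entries []       end = end
isDigit-entries (e ∷ es) {r} end rewrite ++-assoc (encodeEntry′ e) (encodeEntries es) r = isDigit-entry e

isDigit-rows : ∀ rows {z} → isDigit (headOf (encodeRows rows ++ sep ∷ z)) ≡ false
isDigit-rows []                   = refl
isDigit-rows ((player₁ , _) ∷ _) = refl
isDigit-rows ((player₂ , _) ∷ _) = refl

isEntry-rows : ∀ rows {z} → isEntry (headOf (encodeRows rows ++ sep ∷ z)) ≡ false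
isEntry-rows []                   = refl
isEntry-rows ((player₁ , _) ∷ _) = refl
isEntry-rows ((player₂ , _) ∷ _) = refl

isOwner-owner : ∀ o → isOwner (just (encodeOwner o)) ≡ true
isOwner-owner player₁ = refl
isOwner-owner player₂ = refl

copyEntries-loop : ∀ {L} es ls {r} os ts k → isDigit (headOf r) ≡ false → isEntry (headOf r) ≡ false →
  length (encodeEntries es) ≤ L →
  Loop L (isEntry ∘ input) (doubleEntry ⨾ perform (moveAt (suc (suc zero)) goRight)) (length es)
    (at ls (encodeEntries es ++ r) ∷ at os [] ∷ at ts (absents (length es + k)) ∷ [])
    (at (encodeEntries es ʳ++ ls) r
      ∷ at (encodeEntries (map doubled es) ʳ++ os) []
      ∷ at (absents (length es) ʳ++ ts) (absents k) ∷ [])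
copyEntries-loop []       ls os ts k end end′ len = done end′
copyEntries-loop (e ∷ es) ls {r} os ts k end end′ len
  rewrite ++-assoc (encodeEntry′ e) (encodeEntries es) r
        | ++-ʳ++ (encodeEntry′ e) {encodeEntries es} {ls}
        | ++-ʳ++ (encodeEntry′ (doubled e)) {encodeEntries (map doubled es)} {os} =
  iter (isEntry-entry e)
    (doubleEntry-run e ls os (isDigit-entries es end) (≤-trans (length-++-≤ˡ (encodeEntry′ e)) len)
     ⨾ perform (tapes≡ refl refl (right-at absent ts _)))
    (copyEntries-loop es (encodeEntry′ e ʳ++ ls) (encodeEntry′ (doubled e) ʳ++ os) (absent ∷ ts) k end end′
      (≤-trans (length-++-≤ʳ (encodeEntries es) {encodeEntry′ e}) len))

-- Invariant between rows: from the mark on, the template has exactly as many cells as there are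
-- entries left to read.
printFirstRows-loop : ∀ {L} rows j ls {z} os → j + entries rows ≤ L → length (encodeRows rows) ≤ L →
  Loop L (isOwner ∘ input) printFirstRow (length rows)
    (at ls (encodeRows rows ++ sep ∷ z)
      ∷ at os []
      ∷ at [] (absents j ++ mark (absents (entries rows))) ∷ [])
    (at (encodeRows rows ʳ++ ls) (sep ∷ z)
      ∷ at (firstRows j rows ʳ++ os) []
      ∷ at [] (absents (j + entries rows)) ∷ [])
printFirstRows-loop [] j ls os _ _ rewrite ++-identityʳ (absents j) | +-identityʳ j = done refl
printFirstRows-loop {L} ((o , es) ∷ rows) j ls {z} os len len′
  rewrite ++-assoc (encodeEntries es) (encodeRows rows) (sep ∷ z)
        | ++-ʳ++ (encodeEntries es) {encodeRows rows} {encodeOwner o ∷ ls}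
        | ++-ʳ++ (absents j)
            {encodeEntries (map doubled es) ++ absents (entries rows) ++ firstRows (j + length es) rows}
            {encodeOwner o ∷ os}
        | ++-ʳ++ (encodeEntries (map doubled es))
            {absents (entries rows) ++ firstRows (j + length es) rows}
            {absents j ʳ++ encodeOwner o ∷ os}
        | ++-ʳ++ (absents (entries rows))
            {firstRows (j + length es) rows}
            {encodeEntries (map doubled es) ʳ++ (absents j ʳ++ encodeOwner o ∷ os)}
        | sym (+-assoc j (length es) (entries rows)) =
  iter (isOwner-owner o)
    (perform (tapes≡ (right-at _ ls _) refl refl)
     ⨾ columnsBefore-run _ j (length es + entries rows) (m+n≤o⇒m≤o j (m+n≤o⇒m≤o (j + length es) len))
     ⨾ while (m+n≤o⇒n≤o j (m+n≤o⇒m≤o (j + length es) len))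
         (copyEntries-loop es (encodeOwner o ∷ ls) _ _ (entries rows)
           (isDigit-rows rows) (isEntry-rows rows)
           (≤-trans (length-++-≤ˡ (encodeEntries es)) (m+n≤o⇒n≤o 1 len′)))
     ⨾ columnsAfter-run _ j (length es) (entries rows) len)
    (printFirstRows-loop rows (j + length es) _ _ len
      (≤-trans (length-++-≤ʳ (encodeRows rows) {encodeEntries es}) (m+n≤o⇒n≤o 1 len′)))

printSecondRow-loop : ∀ {L} es j k ls {r} os → isDigit (headOf r) ≡ false → isEntry (headOf r) ≡ false →
  j + (length es + k) ≤ L → length (encodeEntries es) ≤ L →
  Loop L (isEntry ∘ input) printSecondRow (length es)
    (at ls (encodeEntries es ++ r) ∷ at os [] ∷ at [] (absents j ++ mark (absents (length es + k))) ∷ [])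
    (at (encodeEntries es ʳ++ ls) r
      ∷ at (secondRow k j es ʳ++ os) []
      ∷ at [] (absents (j + length es) ++ mark (absents k)) ∷ [])
printSecondRow-loop [] j k ls os end end′ _ _ rewrite +-identityʳ j = done end′
printSecondRow-loop (e ∷ es) j k ls {r} os end end′ len len′
  rewrite ++-assoc (encodeEntry′ e) (encodeEntries es) r
        | ++-ʳ++ (encodeEntry′ e) {encodeEntries es} {ls}
        | ++-ʳ++ (absents j)
            {encodeℤ (returning e) ++ absents (length es + k) ++ secondRow k (suc j) es}
            {own₁ ∷ os}
        | ++-ʳ++ (encodeℤ (returning e))
            {absents (length es + k) ++ secondRow k (suc j) es}
            {absents j ʳ++ own₁ ∷ os}
        | ++-ʳ++ (absents (length es + k))
            {secondRow k (suc j) es}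
            {encodeℤ (returning e) ʳ++ (absents j ʳ++ own₁ ∷ os)}
        | +-suc j (length es) | +-suc j (length es + k) =
  iter (isEntry-entry e)
    (perform refl
     ⨾ columnsBefore-run (own₁ ∷ os) j (suc (length es + k)) (≤-trans (m≤n⇒m≤1+n (m≤m+n j _)) len)
     ⨾ returnEntry-run e ls (absents j ʳ++ own₁ ∷ os) (isDigit-entries es end)
         (≤-trans (length-++-≤ˡ (encodeEntry′ e)) len′)
     ⨾ perform (tapes≡ refl refl (right-at absent (absents j ʳ++ []) _))
     ⨾ ending (tapes≡ refl refl
                (cong (λ m → at [] (absents m ++ mark (absents (length es + k)))) (+-comm j 1)))
         (columnsAfter-run _ j 1 (length es + k)
           (≤-trans (≤-reflexive (cong (_+ (length es + k)) (+-comm j 1))) len)))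
    (printSecondRow-loop es (suc j) k _ _ end end′ len
      (≤-trans (length-++-≤ʳ (encodeEntries es) {encodeEntry′ e}) len′))

-- All rows have the same length, so the length `N` of the template is preserved. Its final content
-- is existential because without rows it is still `v`.
printSecondRows-loop : ∀ {L N k} rows v ls {z} os →
  All (λ (_ , es) → length es + k ≡ N) rows → length v ≡ N → N ≤ L → length (encodeRows rows) ≤ L →
  ∃[ v′ ] Loop L (isOwner ∘ input)
    (perform (moveAt zero goRight) ⨾ resetTemplate ⨾ while (isEntry ∘ input) printSecondRow) (length rows)
    (at ls (encodeRows rows ++ sep ∷ z) ∷ at os [] ∷ at [] v ∷ [])
    (at (encodeRows rows ʳ++ ls) (sep ∷ z) ∷ at (secondRows k rows ʳ++ os) [] ∷ at [] v′ ∷ [])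
printSecondRows-loop []                v ls os _ _ _ _ = v , done refl
printSecondRows-loop {L} {_} {k} ((o , es) ∷ rows) v ls {z} os (refl ∷ ns) lv len len′
  rewrite ++-assoc (encodeEntries es) (encodeRows rows) (sep ∷ z)
        | ++-ʳ++ (encodeEntries es) {encodeRows rows} {encodeOwner o ∷ ls}
        | ++-ʳ++ (secondRow k 0 es) {secondRows k rows} {os} =
  let v′ , l = printSecondRows-loop rows (absents (length es) ++ mark (absents k)) _ _ ns
                 (trans (length-++ (absents (length es)))
                   (cong₂ _+_ (length-replicate (length es))
                     (trans (length-mark (absents k)) (length-replicate k))))
                 len
                 (≤-trans (length-++-≤ʳ (encodeRows rows) {encodeEntries es}) (m+n≤o⇒n≤o 1 len′))
  in v′ , iter (isOwner-owner o)
    (perform (tapes≡ (right-at _ ls _) refl refl)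
     ⨾ ending (tapes≡ refl refl (cong (λ m → at [] (mark (absents m))) lv))
         (resetTemplate-run v (≤-trans (≤-reflexive lv) len))
     ⨾ while (m+n≤o⇒m≤o (length es) len)
         (printSecondRow-loop es 0 k (encodeOwner o ∷ ls) os (isDigit-rows rows) (isEntry-rows rows)
             len (≤-trans (length-++-≤ˡ (encodeEntries es)) (m+n≤o⇒n≤o 1 len′))))
    l

-- The complete program and its running time.

copyRest main : Program
copyRest  = while (is-just ∘ input) (perform copy)
main = normalise ⨾ measure ⨾ locate ⨾ printFirstRows ⨾ rewind zero ⨾ printSecondRows ⨾ copyRest

copyRest-loop : ∀ {L} w ls os {t} →
  Loop L (is-just ∘ input) (perform copy) (length w)
    (at ls w ∷ at os [] ∷ t ∷ []) (at (w ʳ++ ls) [] ∷ at (w ʳ++ os) [] ∷ t ∷ [])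
copyRest-loop []      ls os = done refl
copyRest-loop (x ∷ w) ls os =
  iter refl (perform (tapes≡ (right-at x ls w) refl refl)) (copyRest-loop w (x ∷ ls) (x ∷ os))

reduce : ℕ → List Row → Word → Word
reduce k rows z = firstRows (length rows) rows ++ secondRows k rows ++ sep ∷ z

-- Every loop runs over a piece of the input or of the template, and the template has at most one
-- cell per input symbol. Hence `length w` bounds all of them.
main-run : ∀ {k} rows z → All (λ (_ , es) → length es + k ≡ length rows + entries rows) rows →
  let w = encodeRows rows ++ sep ∷ z in
  ∃[ i ] ∃[ t ] Run (length w) main (load w ∷ blankTape ∷ blankTape ∷ [])
                  (i ∷ at (reduce k rows z ʳ++ []) [] ∷ t ∷ [])
main-run {k} rows z ns
  rewrite ++-ʳ++ (firstRows (length rows) rows) {secondRows k rows ++ sep ∷ z} {[]}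
        | ++-ʳ++ (secondRows k rows) {sep ∷ z} {firstRows (length rows) rows ʳ++ []} =
  let t , l = printSecondRows-loop rows (absents (length rows + entries rows)) [] _ ns
                (length-replicate _) cols len
  in _ , _ ,
    (normalise-run w ≤-refl
     ⨾ measure-run (encodeRows rows) (rows-game rows) len
     ⨾ starting (tapes≡ refl refl (cong (at []) template≡)) 
         (ending (tapes≡ refl refl
                   (cong (λ n → at [] (absents n ++ mark (absents (entries rows)))) (owners-rows rows)))
           (locate-run (encodeRows rows) (absents (entries rows)) (rows-game rows) len))
     ⨾ while (m+n≤o⇒m≤o (length rows) cols)
         (printFirstRows-loop rows (length rows) [] [] cols len)
     ⨾ rewind-input (encodeRows rows) (sep ∷ z) len
     ⨾ while (m+n≤o⇒m≤o (length rows) cols) l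
     ⨾ while (length-++-≤ʳ (sep ∷ z) {encodeRows rows}) (copyRest-loop (sep ∷ z) _ _))
  where
  w = encodeRows rows ++ sep ∷ z

  len : length (encodeRows rows) ≤ length w
  len = length-++-≤ˡ (encodeRows rows)

  cols : length rows + entries rows ≤ length w
  cols = ≤-trans (≤-trans (≤-reflexive (sym (marks-rows rows)))
                          (count≤length isMark (encodeRows rows))) len

  template≡ : absents (count isMark (encodeRows rows)) ≡
              absents (count isOwner (encodeRows rows)) ++ absents (entries rows)
  template≡ = trans (cong absents (trans (marks-rows rows)
                                         (cong (_+ entries rows) (sym (owners-rows rows)))))
                    (absents-+ (count isOwner (encodeRows rows)) (entries rows))

-- The output can be longer than the input, so `length w` does not bound the last rewind. It is kept
-- apart from `main`, whose running time bounds the output.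
reduction : Program
reduction = main ⨾ rewind (suc zero)

reductionTime : ℕ → ℕ
reductionTime n = cost main n + cost (rewind (suc zero)) (cost main n)

-- scan names the local function readCells of contents, which is lifted over
-- the components of the tape; the with-abstraction separates them from its argument.

mutual
  scan : List Cell → Cell → List Cell → List Cell → Word
  scan l h r cs = _

  contents-scan : ∀ l h r → contents (tape l h r) ≡ scan l h r (h ∷ r)
  contents-scan l h r with h ∷ r
  ... | cs = refl

scan-cells : ∀ l h r w → scan l h r (cells w) ≡ w
scan-cells l h r []      = refl
scan-cells l h r (x ∷ w) = cong (x ∷_) (scan-cells l h r w)

contents-at : ∀ w → contents (at [] w) ≡ w
contents-at []      = refl
contents-at (x ∷ w) = cong (x ∷_) (scan-cells [] (just x) (cells w) w)

reduction-halts : ∀ {k} rows z → All (λ (_ , es) → length es + k ≡ length rows + entries rows) rows →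
  let w = encodeRows rows ++ sep ∷ z in
  ∃[ n ] n ≤ reductionTime (length w)
       × HaltsIn (compile reduction) n (initialConfiguration (compile reduction) w) (reduce k rows z)
reduction-halts {k} rows z ns =
  let i , t , r    = main-run rows z ns
      m , m≤ , x   = run⇒exits r
      -- The output tape starts with no cell listed to the left of its head, so after `m` steps at
      -- most `m` are.
      m′ , m′≤ , y = run⇒exits (rewind-output {i = i} {t = t} (reduce k rows z) []
                                  (printed (length-left (suc zero) x) m≤))
  in m + m′ , +-mono-≤ m≤ m′≤ , exits⇒halts (exits-⨾ x y) (trans (contents-at _) (++-identityʳ _))
  where
  printed : ∀ {m n} → length (Tape.left (at (reduce k rows z ʳ++ []) [])) ≤ m → m ≤ n →
            length (reduce k rows z) ≤ n
  printed {m} le = ≤-trans (≤-trans (m≤m+n _ 1) (≤-trans (≤-reflexive (sym (begin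
    length (map just u ++ nothing ∷ [])       ≡⟨ length-++ (map just u) ⟩
    length (map just u) + 1                   ≡⟨ cong (_+ 1) (length-map just u) ⟩
    length u + 1                              ≡⟨ cong (_+ 1) (length-ʳ++ (reduce k rows z)) ⟩
    length (reduce k rows z) + 0 + 1          ≡⟨ cong (_+ 1) (+-identityʳ _) ⟩
    length (reduce k rows z) + 1              ∎))) le))
    where
    open ≡-Reasoning
    u = reduce k rows z ʳ++ []

reductionTime-polynomial : Polynomial reductionTime
reductionTime-polynomial =
  polynomial-+ (polynomial-cost main polynomial-id)
    (polynomial-cost (rewind (suc zero)) (polynomial-cost main polynomial-id))

-- The split game

-- next applies a local function to owner s and refl.  next₀ and next₁ name that
-- function at variable arguments: their bodies are metavariables solved by the
-- refl below, and Owned keeps owner s out of the type of the second argument, so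
-- that owner s can be abstracted.

record Owned (G : Game) (s : Game.State G) (i : Player) : Set where
  constructor owned
  field owned-by : Game.owner G s ≡ i
open Owned

module _ {G : Game} {s₀ : Game.State G}
         (σ : Strategy G player₁ s₀) (τ : Strategy G player₂ s₀) where
  open Game G

  mutual
    next₀ : ∀ {s} → Prefix G s₀ s → owner s ≡ owner s → Successor G s
    next₀ h p = _

    next≡next₀ : ∀ {s} (h : Prefix G s₀ s) → next σ τ h ≡ next₀ h refl
    next≡next₀ {s} h with refl {x = owner s}
    ... | p = refl

  mutual
    next₁ : ∀ {s} → Prefix G s₀ s → (i : Player) → Owned G s i → Successor G s
    next₁ h i w = _

    next₀≡next₁ : ∀ {s} (h : Prefix G s₀ s) (w : Owned G s (owner s)) →
                  next₀ h (owned-by w) ≡ next₁ h (owner s) w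
    next₀≡next₁ {s} h w with owner s
    ... | i = refl

  -- Once `i` is a constructor, `next₁` computes to the choice of `σ` or `τ`.
  next≡next₁ : ∀ {s} (h : Prefix G s₀ s) {i} (p : owner s ≡ i) → next σ τ h ≡ next₁ h i (owned p)
  next≡next₁ h refl = trans (next≡next₀ h) (next₀≡next₁ h (owned refl))

value : (e : Entry) → T (is-just e) → ℤ
value (just z) _ = z

matrixGame : ∀ n → (Fin n → Player) → (m : Fin n → Fin n → Entry) →
             (∀ s → ∃[ s′ ] T (is-just (m s s′))) → Game
matrixGame n owner m total = record
  { size  = n
  ; owner = owner
  ; E     = λ s s′ → is-just (m s s′)
  ; w     = λ {s} {s′} → value (m s s′)
  ; total = total
  }

-- The edge bit is an argument of its own so that it can be matched on although the type of the
-- weight depends on it.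
entryOf : (b : Bool) → (T b → ℤ) → Entry
entryOf true  w = just (w tt)
entryOf false w = nothing

module Split (G : Game) where
  open Game G

  weight : State → State → Entry
  weight s s′ = entryOf (E s s′) w

  -- inj₁ s is an original state; inj₂ (a , b) is halfway from a to b.

  Kind : Set
  Kind = State ⊎ (State × State)

  -- Original states come first and pairs follow row by row, which is the order in which the program
  -- prints. Original states keep their numbers, so the unary initial state is copied unchanged.
  kind : Fin (size + size * size) → Kind
  kind p = Sum.map₂ (remQuot size) (splitAt size p)

  code : Kind → Fin (size + size * size)
  code (inj₁ s)       = s ↑ˡ (size * size)
  code (inj₂ (a , b)) = size ↑ʳ combine a b

  kind-code : ∀ k → kind (code k) ≡ k
  kind-code (inj₁ s)       = cong (Sum.map₂ (remQuot size)) (splitAt-↑ˡ size s (size * size))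
  kind-code (inj₂ (a , b)) =
    trans (cong (Sum.map₂ (remQuot size)) (splitAt-↑ʳ size (size * size) (combine a b)))
          (cong inj₂ (remQuot-combine a b))

  code-kind : ∀ p → code (kind p) ≡ p
  code-kind p = trans (lemma (splitAt size p)) (join-splitAt size (size * size) p)
    where
    lemma : ∀ x → code (Sum.map₂ (remQuot size) x) ≡ join size (size * size) x
    lemma (inj₁ s) = refl
    lemma (inj₂ q) = cong (size ↑ʳ_) (combine-remQuot {size} size q)

  -- A midpoint has a single successor, so whoever owns it has no choice there.
  splitOwner : Kind → Player
  splitOwner (inj₁ s) = owner s
  splitOwner (inj₂ _) = player₁

  splitWeight : Kind → Kind → Entry
  splitWeight (inj₁ s)       (inj₂ (a , b)) = if does (s ≟ a) then doubled (weight s b) else nothing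
  splitWeight (inj₂ (a , b)) (inj₁ s)       = if does (b ≟ s) then just (returning (weight a b)) else nothing
  splitWeight (inj₁ _)       (inj₁ _)       = nothing
  splitWeight (inj₂ _)       (inj₂ _)       = nothing

  Edge : Kind → Kind → Set
  Edge k k′ = T (is-just (splitWeight k k′))

  edge-doubled : ∀ b (w : T b → ℤ) (e : T b) (x : T (is-just (doubled (entryOf b w)))) →
                 value (doubled (entryOf b w)) x ≡ w e ℤ.+ w e
  edge-doubled true w e x = refl

  forward : ∀ {s b} → T (E s b) → Edge (inj₁ s) (inj₂ (s , b))
  forward {s} {b} e with s ≟ s
  ... | no s≢s = contradiction refl s≢s
  ... | yes _  = go (E s b) w e
    where
    go : ∀ b (w : T b → ℤ) → T b → T (is-just (doubled (entryOf b w)))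
    go true w _ = tt

  backward : ∀ a b → Edge (inj₂ (a , b)) (inj₁ b)
  backward a b with b ≟ b
  ... | yes _  = tt
  ... | no b≢b = contradiction refl b≢b

  forward⁻¹ : ∀ {s a b} → Edge (inj₁ s) (inj₂ (a , b)) → s ≡ a × T (E s b)
  forward⁻¹ {s} {a} {b} x with s ≟ a
  ... | yes s≡a = s≡a , go (E s b) w x
    where
    go : ∀ b (w : T b → ℤ) → T (is-just (doubled (entryOf b w))) → T b
    go true w _ = tt

  backward⁻¹ : ∀ {a b s} → Edge (inj₂ (a , b)) (inj₁ s) → b ≡ s
  backward⁻¹ {a} {b} {s} x with b ≟ s
  ... | yes b≡s = b≡s

  forward-value : ∀ {s b} (e : T (E s b)) (x : Edge (inj₁ s) (inj₂ (s , b))) →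
                  value (splitWeight (inj₁ s) (inj₂ (s , b))) x ≡ w e ℤ.+ w e
  forward-value {s} {b} e x with s ≟ s
  ... | yes _ = edge-doubled (E s b) w e x

  backward-value : ∀ {s b} (e : T (E s b)) (x : Edge (inj₂ (s , b)) (inj₁ b)) →
                   value (splitWeight (inj₂ (s , b)) (inj₁ b)) x ≡ ℤ.- (w e ℤ.+ w e)
  backward-value {s} {b} e x with b ≟ b
  ... | yes _ = go (E s b) w e
    where
    go : ∀ b (w : T b → ℤ) (e : T b) → returning (entryOf b w) ≡ ℤ.- (w e ℤ.+ w e)
    go true w _ = refl

  splitTotal : ∀ k → ∃[ k′ ] Edge k k′
  splitTotal (inj₁ s)       = let b , e = total s in inj₂ (s , b) , forward e
  splitTotal (inj₂ (a , b)) = inj₁ b , backward a b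

  encodeKind : ∀ k → (∃[ k′ ] Edge k k′) → ∃[ q ] Edge k (kind q)
  encodeKind k (k′ , x) = code k′ , subst (Edge k) (sym (kind-code k′)) x

  split : Game
  split = matrixGame (size + size * size) (splitOwner ∘ kind) (λ p q → splitWeight (kind p) (kind q))
            (λ p → encodeKind (kind p) (splitTotal (kind p)))

  ι : State → Game.State split
  ι s = code (inj₁ s)

  κ : State → State → Game.State split
  κ a b = code (inj₂ (a , b))

  edge-ικ : ∀ {s b} → T (E s b) → Edge (kind (ι s)) (kind (κ s b))
  edge-ικ {s} {b} e = subst₂ Edge (sym (kind-code (inj₁ s))) (sym (kind-code (inj₂ (s , b)))) (forward e)

  edge-κι : ∀ a b → Edge (kind (κ a b)) (kind (ι b))
  edge-κι a b = subst₂ Edge (sym (kind-code (inj₂ (a , b)))) (sym (kind-code (inj₁ b))) (backward a b)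

  -- Transfer of prefixes, strategies and outcomes.

  module _ (s₀ : State) where

    -- A step counts as taken once its first half is: a prefix ending halfway from a to b projects
    -- to one ending in b.
    target : Kind → State
    target (inj₁ s)       = s
    target (inj₂ (a , b)) = b

    extend : ∀ k k′ → Edge k k′ → Prefix G s₀ (target k) → Prefix G s₀ (target k′)
    extend (inj₁ s) (inj₂ (a , b)) x h = h ▸ proj₂ (forward⁻¹ x)
    extend (inj₂ (a , b)) (inj₁ s) x h = subst (Prefix G s₀) (backward⁻¹ {a} x) h

    project : ∀ {p} → Prefix split (ι s₀) p → Prefix G s₀ (target (kind p))
    project start                     = subst (Prefix G s₀ ∘ target) (sym (kind-code (inj₁ s₀))) start
    project (_▸_ {p} {q} h x) = extend (kind p) (kind q) x (project h)

    embed : ∀ {s} → Prefix G s₀ s → Prefix split (ι s₀) (ι s)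
    embed start               = start
    embed (_▸_ {s} {b} h e) = embed h ▸ edge-ικ e ▸ edge-κι s b

    History : Set
    History = ∃[ s ] Prefix G s₀ s

    -- `kind (code k)` equals `k` only propositionally. The kinds are therefore variables with
    -- equations that can be matched by `refl`, and prefixes are compared together with their last
    -- states, which avoids transports.
    extend-forward : ∀ {s b} {h : Prefix G s₀ s} {e : T (E s b)} k k′ (x : Edge k k′) (h′ : Prefix G s₀ (target k)) →
      k ≡ inj₁ s → k′ ≡ inj₂ (s , b) → _≡_ {A = History} (target k , h′) (s , h) →
      _≡_ {A = History} (target k′ , extend k k′ x h′) (b , h ▸ e)
    extend-forward {s} {b} {h} _ _ x _ refl refl refl = cong (λ e → b , h ▸ e) (T-irrelevant _ _)

    extend-backward : ∀ {a b} {h : Prefix G s₀ b} k k′ (x : Edge k k′) (h′ : Prefix G s₀ (target k)) →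
      k ≡ inj₂ (a , b) → k′ ≡ inj₁ b → _≡_ {A = History} (target k , h′) (b , h) →
      _≡_ {A = History} (target k′ , extend k k′ x h′) (b , h)
    extend-backward {a} {b} {h} _ _ x _ refl refl refl =
      cong (λ p → b , subst (Prefix G s₀) p h) (uip (backward⁻¹ {a} x) refl)

    project-start : ∀ k (p : inj₁ s₀ ≡ k) →
      _≡_ {A = History} (target k , subst (Prefix G s₀ ∘ target) p start) (s₀ , start)
    project-start _ refl = refl

    project-embed : ∀ {s} (h : Prefix G s₀ s) →
      _≡_ {A = History} (target (kind (ι s)) , project (embed h)) (s , h)
    project-embed start = project-start (kind (ι s₀)) (sym (kind-code (inj₁ s₀)))
    project-embed (_▸_ {s} {b} h e) =
      extend-backward (kind (κ s b)) (kind (ι b)) (edge-κι s b) _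
        (kind-code (inj₂ (s , b))) (kind-code (inj₁ b))
        (extend-forward (kind (ι s)) (kind (κ s b)) (edge-ικ e) _
          (kind-code (inj₁ s)) (kind-code (inj₂ (s , b)))
          (project-embed h))

    -- A relation instead of a map, because each direction of the theorem lifts the strategy of one
    -- player and drops that of the other. Embedded prefixes suffice: they are what a play of the
    -- split game passes through at even positions, and the moves in between are forced.
    Corresponding : ∀ i → Strategy G i s₀ → Strategy split i (ι s₀) → Set
    Corresponding i σ σ′ = ∀ {s} (h : Prefix G s₀ s) (o : owner s ≡ i) (o′ : splitOwner (kind (ι s)) ≡ i) →
                           proj₁ (σ′ (embed h) o′) ≡ κ s (proj₁ (σ h o))

    module _ {i : Player} where

      choice : Strategy G i s₀ → ∀ k → Prefix G s₀ (target k) → splitOwner k ≡ i → ∃[ k′ ] Edge k k′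
      choice σ (inj₁ s)       h o = let b , e = σ h o in inj₂ (s , b) , forward e
      choice σ (inj₂ (a , b)) _ _ = inj₁ b , backward a b

      lift : Strategy G i s₀ → Strategy split i (ι s₀)
      lift σ {p} h o = encodeKind (kind p) (choice σ (kind p) (project h) o)

      lift-corresponding : (σ : Strategy G i s₀) → Corresponding i σ (lift σ)
      lift-corresponding σ {s} h o o′ =
        cong code (go (kind (ι s)) (project (embed h)) o′ (kind-code (inj₁ s)) (project-embed h))
        where
        go : ∀ k (h′ : Prefix G s₀ (target k)) o′ → k ≡ inj₁ s → _≡_ {A = History} (target k , h′) (s , h) →
             proj₁ (choice σ k h′ o′) ≡ inj₂ (s , proj₁ (σ h o))
        go _ _ o′ refl refl = cong (λ o → inj₂ (s , proj₁ (σ h o))) (uip o′ o)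

      halfway : ∀ {s} k → Edge (inj₁ s) k → ∃[ b ] T (E s b) × k ≡ inj₂ (s , b)
      halfway (inj₂ (a , b)) x with refl , e ← forward⁻¹ x = b , e , refl

      owner-ι : ∀ {s} → owner s ≡ i → splitOwner (kind (ι s)) ≡ i
      owner-ι {s} = trans (cong splitOwner (kind-code (inj₁ s)))

      descend : ∀ {s} → Successor split (ι s) → ∃[ b ] T (E s b) × ∃[ q ] kind q ≡ inj₂ (s , b)
      descend {s} (q , x) =
        let b , e , eq = halfway (kind q) (subst (λ k → Edge k (kind q)) (kind-code (inj₁ s)) x)
        in b , e , q , eq

      drop : Strategy split i (ι s₀) → Strategy G i s₀
      drop σ′ h o = let b , e , _ = descend (σ′ (embed h) (owner-ι o)) in b , e

      drop-corresponding : (σ′ : Strategy split i (ι s₀)) → Corresponding i (drop σ′) σ′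
      drop-corresponding σ′ h o o′ rewrite uip o′ (owner-ι o) =
        let _ , _ , q , eq = descend (σ′ (embed h) (owner-ι o))
        in trans (sym (code-kind q)) (cong code eq)

    module _ {σ : Strategy G player₁ s₀} {τ : Strategy G player₂ s₀}
             {σ′ : Strategy split player₁ (ι s₀)} {τ′ : Strategy split player₂ (ι s₀)}
             (σ~ : Corresponding player₁ σ σ′) (τ~ : Corresponding player₂ τ τ′) where

      next-ι : ∀ {s} (h : Prefix G s₀ s) → proj₁ (next σ′ τ′ (embed h)) ≡ κ s (proj₁ (next σ τ h))
      next-ι {s} h = go (owner s) refl
        where
        go : ∀ i → owner s ≡ i → proj₁ (next σ′ τ′ (embed h)) ≡ κ s (proj₁ (next σ τ h))
        go player₁ o
          rewrite next≡next₁ σ τ h o | next≡next₁ σ′ τ′ (embed h) (owner-ι o) = σ~ h o (owner-ι o)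
        go player₂ o
          rewrite next≡next₁ σ τ h o | next≡next₁ σ′ τ′ (embed h) (owner-ι o) = τ~ h o (owner-ι o)

      only-successor : ∀ {a b} k k′ → k ≡ inj₂ (a , b) → Edge k k′ → k′ ≡ inj₁ b
      only-successor {a} _ (inj₁ s) refl x = cong inj₁ (sym (backward⁻¹ {a} x))

      next-κ : ∀ {a b} (h : Prefix split (ι s₀) (κ a b)) → proj₁ (next σ′ τ′ h) ≡ ι b
      next-κ {a} {b} h = let q , x = next σ′ τ′ h in
        trans (sym (code-kind q))
          (cong code (only-successor (kind (κ a b)) (kind q) (kind-code (inj₂ (a , b))) x))

      History′ : Set
      History′ = ∃[ p ] Prefix split (ι s₀) p

      append : (h : History′) → Successor split (proj₁ h) → History′
      append (_ , h) (q , x) = q , h ▸ x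

      step-history : History′ → History′
      step-history (_ , h) = append (_ , h) (next σ′ τ′ h)

      append-≡ : ∀ (h : History′) {q} (y : Successor split (proj₁ h)) (x : Edge (kind (proj₁ h)) (kind q)) →
                 proj₁ y ≡ q → append h y ≡ (q , proj₂ h ▸ x)
      append-≡ (_ , h) (q , y) x refl = cong (λ x → q , h ▸ x) (T-irrelevant y x)

      -- The induction needs equal histories and not just equal states, since strategies see the
      -- whole prefix.
      history-ι : ∀ n → let s , h = history σ τ n in
                  _≡_ {A = History′} (history σ′ τ′ (n * 2)) (ι s , embed h)
      history-ικ : ∀ n → let s , h = history σ τ n ; b , e = next σ τ h in
                   _≡_ {A = History′} (history σ′ τ′ (suc (n * 2))) (κ s b , embed h ▸ edge-ικ e)
      history-ικ n = let s , h = history σ τ n ; b , e = next σ τ h in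
        trans (cong step-history (history-ι n)) (append-≡ (ι s , embed h) _ (edge-ικ e) (next-ι h))

      history-ι zero    = refl
      history-ι (suc n) = let s , h = history σ τ n ; b , e = next σ τ h in
        trans (cong step-history (history-ικ n))
              (append-≡ (κ s b , embed h ▸ edge-ικ e) _ (edge-κι s b) (next-κ (embed h ▸ edge-ικ e)))

      history-κ : ∀ n → proj₁ (history σ′ τ′ (suc (n * 2))) ≡
                        κ (proj₁ (history σ τ n)) (proj₁ (history σ τ (suc n)))
      history-κ n = cong proj₁ (history-ικ n)

-- Means

-- Normalisation may cancel in `i ℚ./ suc m`, so the comparison passes through the unnormalised
-- fraction `mkℚᵘ i m`.
/≤⇒*≤* : ∀ i m r → i ℚ./ suc m ℚ.≤ r → i ℤ.* ↧ r ℤ.≤ ↥ r ℤ.* + suc m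
/≤⇒*≤* i m r@(mkℚ _ _ _) i/m≤r = ℚᵘ.drop-*≤*
  (ℚᵘ.≤-respˡ-≃ (ℚ.toℚᵘ-fromℚᵘ (mkℚᵘ i m)) (ℚ.toℚᵘ-mono-≤ i/m≤r))

*≤*⇒/≤ : ∀ i m r → i ℤ.* ↧ r ℤ.≤ ↥ r ℤ.* + suc m → i ℚ./ suc m ℚ.≤ r
*≤*⇒/≤ i m r@(mkℚ _ _ _) le = ℚ.toℚᵘ-cancel-≤
  (ℚᵘ.≤-respˡ-≃ (ℚᵘ.≃-sym (ℚ.toℚᵘ-fromℚᵘ (mkℚᵘ i m))) (ℚᵘ.*≤* le))

-- An odd number 2n + 1 of terms only rescales the mean by (2n + 2) / (2n + 1),
-- which the strict inequality r < r′ absorbs as soon as n is large.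

odd-mean : ∀ n i r r′ → r ℚ.< r′ → ∣ ↥ r ∣ ℕ.* ↧ₙ r′ ℕ.≤ n →
           i ℤ.* ↧ r ℤ.≤ ↥ r ℤ.* + suc n → (i ℤ.+ i) ℤ.* ↧ r′ ℤ.≤ ↥ r′ ℤ.* + suc (n ℕ.* 2)
odd-mean n i r@(mkℚ p d₁ _) r′@(mkℚ p′ d₁′ _) (*<* r<r′) n≥ le =
  ℤ.*-cancelʳ-≤-pos _ _ d (begin
    (i ℤ.+ i) ℤ.* d′ ℤ.* d                          ≡⟨ solve 3 (λ i d d′ →
      (i :+ i) :* d′ :* d := (i :* d) :* (d′ :+ d′)) refl i d d′ ⟩
    (i ℤ.* d) ℤ.* (d′ ℤ.+ d′)                       ≤⟨ ℤ.*-monoʳ-≤-nonNeg (d′ ℤ.+ d′) le ⟩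
    (p ℤ.* (ℤ.1ℤ ℤ.+ + n)) ℤ.* (d′ ℤ.+ d′)          ≡⟨ solve 3 (λ p d′ n →
      (p :* (con ℤ.1ℤ :+ n)) :* (d′ :+ d′) := p :* d′ :* (con ℤ.1ℤ :+ (n :+ n)) :+ p :* d′) refl p d′ (+ n) ⟩
    -- The extra term comes from 2n + 2 = `N` + 1. It is at most `N`, and the gap of at least 1
    -- between the integers p d′ and p′ d absorbs one `N`.
    p ℤ.* d′ ℤ.* N ℤ.+ p ℤ.* d′                     ≤⟨ ℤ.+-monoʳ-≤ (p ℤ.* d′ ℤ.* N) pd′≤N ⟩
    p ℤ.* d′ ℤ.* N ℤ.+ N                            ≡⟨ solve 2 (λ x N →
      x :* N :+ N := (con ℤ.1ℤ :+ x) :* N) refl (p ℤ.* d′) N ⟩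
    ℤ.suc (p ℤ.* d′) ℤ.* N                          ≤⟨ ℤ.*-monoʳ-≤-nonNeg N (ℤ.i<j⇒suc[i]≤j r<r′) ⟩
    p′ ℤ.* d ℤ.* N                                  ≡⟨ solve 3 (λ p′ d N →
      p′ :* d :* N := p′ :* N :* d) refl p′ d N ⟩
    p′ ℤ.* N ℤ.* d                                  ≡⟨ cong (λ m → p′ ℤ.* m ℤ.* d) N≡ ⟩
    p′ ℤ.* + suc (n ℕ.* 2) ℤ.* d                    ∎)
  where
  open ℤ.≤-Reasoning
  open ℤSolver.+-*-Solver
  d  = + suc d₁
  d′ = + suc d₁′
  N  = + suc (n ℕ.+ n)

  N≡ : N ≡ + suc (n ℕ.* 2)
  N≡ = cong (λ m → + suc m) (trans (cong (n ℕ.+_) (sym (ℕ.+-identityʳ n))) (ℕ.*-comm 2 n))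

  i≤∣i∣ : ∀ i → i ℤ.≤ + ∣ i ∣
  i≤∣i∣ (+ n)    = ℤ.≤-refl
  i≤∣i∣ -[1+ n ] = -≤+

  pd′≤N : p ℤ.* d′ ℤ.≤ N
  pd′≤N = ℤ.≤-trans (i≤∣i∣ (p ℤ.* d′)) (+≤+ (ℕ.≤-trans (ℕ.≤-reflexive (ℤ.abs-* p d′))
            (ℕ.≤-trans n≥ (ℕ.m≤n⇒m≤1+n (ℕ.m≤m+n n n)))))

even-mean : ∀ n i r → i ℤ.* ↧ r ℤ.≤ ↥ r ℤ.* + suc n ⇔ (i ℤ.+ i) ℤ.* ↧ r ℤ.≤ ↥ r ℤ.* + (suc n ℕ.* 2)
even-mean n i r = mk⇔
  (λ le → subst₂ ℤ._≤_ lhs rhs (ℤ.*-monoʳ-≤-nonNeg (+ 2) le))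
  (λ le → ℤ.*-cancelʳ-≤-pos _ _ (+ 2) (subst₂ ℤ._≤_ (sym lhs) (sym rhs) le))
  where
  open ℤSolver.+-*-Solver
  lhs : i ℤ.* ↧ r ℤ.* + 2 ≡ (i ℤ.+ i) ℤ.* ↧ r
  lhs = solve 2 (λ i d → i :* d :* con (+ 2) := (i :+ i) :* d) refl i (↧ r)
  rhs : ↥ r ℤ.* + suc n ℤ.* + 2 ≡ ↥ r ℤ.* + (suc n ℕ.* 2)
  rhs = trans (ℤ.*-assoc (↥ r) (+ suc n) (+ 2)) (cong (↥ r ℤ.*_) (sym (ℤ.pos-* (suc n) 2)))

parity : ∀ m → ∃[ n ] (m ≡ n ℕ.* 2 ⊎ m ≡ suc (n ℕ.* 2))
parity zero    = 0 , inj₁ refl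
parity (suc m) with parity m
... | n , inj₁ refl = n , inj₂ refl
... | n , inj₂ refl = suc n , inj₁ refl

module _ (u v : ℕ → ℤ)
         (odd  : ∀ n → v (suc (n ℕ.* 2)) ≡ u (suc n) ℤ.+ u (suc n))
         (even : ∀ n → v (suc n ℕ.* 2) ≡ u (suc n) ℤ.+ u (suc n)) where

  open Equivalence

  -- The mean of `v` at 2n + 2 is exactly that of `u` at n + 1, which gives `back`. In `forth` the
  -- means at odd arguments may overshoot `r`, so it is relaxed to some `r′` still below `q`.
  limsup-means : ∀ t → limsup (λ m → u (suc m) ℚ./ suc m) ≤ᵘ t ⇔ limsup (λ m → v (suc m) ℚ./ suc m) ≤ᵘ t
  limsup-means t = mk⇔ forth back
    where
    back : limsup (λ m → v (suc m) ℚ./ suc m) ≤ᵘ t → limsup (λ m → u (suc m) ℚ./ suc m) ≤ᵘ t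
    back V q t<q with V q t<q
    ... | N , r , r<q , bound = N , r , r<q , λ n N≤n →
      *≤*⇒/≤ (u (suc n)) n r (from (even-mean n (u (suc n)) r)
        (subst (λ i → i ℤ.* ↧ r ℤ.≤ ↥ r ℤ.* + (suc n ℕ.* 2)) (even n)
          (/≤⇒*≤* (v (suc n ℕ.* 2)) (suc (n ℕ.* 2)) r
            (bound (suc (n ℕ.* 2)) (ℕ.≤-trans N≤n (ℕ.m≤n⇒m≤1+n (ℕ.m≤m*n n 2)))))))

    forth : limsup (λ m → u (suc m) ℚ./ suc m) ≤ᵘ t → limsup (λ m → v (suc m) ℚ./ suc m) ≤ᵘ t
    forth U q t<q with U q t<q
    ... | N , r , r<q , bound with ℚ.<-dense r<q
    ... | r′ , r<r′ , r′<q = suc (M ℕ.* 2) , r′ , r′<q , λ m M≤m → go m M≤m (parity m)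
      where
      -- `N` is for the bound on `u`, the product for `odd-mean`. An index from 2M + 1 on is 2n or
      -- 2n + 1 with n at least `M`.
      M = N ℕ.+ ∣ ↥ r ∣ ℕ.* ↧ₙ r′

      large : ∀ {n} → M ℕ.* 2 ℕ.≤ n ℕ.* 2 → M ℕ.≤ n
      large = ℕ.*-cancelʳ-≤ _ _ 2

      mean : ∀ n → M ℕ.≤ n → u (suc n) ℤ.* ↧ r ℤ.≤ ↥ r ℤ.* + suc n
      mean n M≤n = /≤⇒*≤* (u (suc n)) n r (bound n (ℕ.m+n≤o⇒m≤o N M≤n))

      go : ∀ m → suc (M ℕ.* 2) ℕ.≤ m → ∃[ n ] (m ≡ n ℕ.* 2 ⊎ m ≡ suc (n ℕ.* 2)) → v (suc m) ℚ./ suc m ℚ.≤ r′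
      go _ M≤m (n , inj₁ refl) = *≤*⇒/≤ (v (suc (n ℕ.* 2))) (n ℕ.* 2) r′
        (subst (λ i → i ℤ.* ↧ r′ ℤ.≤ ↥ r′ ℤ.* + suc (n ℕ.* 2)) (sym (odd n))
          (odd-mean n (u (suc n)) r r′ r<r′ (ℕ.m+n≤o⇒n≤o N M≤n) (mean n M≤n)))
        where M≤n = large {n} (ℕ.≤-trans (ℕ.n≤1+n _) M≤m)
      go _ M≤m (n , inj₂ refl) = ℚ.≤-trans
        (*≤*⇒/≤ (v (suc n ℕ.* 2)) (suc (n ℕ.* 2)) r
          (subst (λ i → i ℤ.* ↧ r ℤ.≤ ↥ r ℤ.* + (suc n ℕ.* 2)) (sym (even n))
            (to (even-mean n (u (suc n)) r) (mean n (large {n} (ℕ.s≤s⁻¹ M≤m))))))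
        (ℚ.<⇒≤ r<r′)

-- Encodings

words : ∀ {n} → (Fin n → Word) → Word
words f = concat (tabulate f)

words-cong : ∀ {n} {f g : Fin n → Word} → (∀ i → f i ≡ g i) → words f ≡ words g
words-cong f≗g = cong concat (tabulate-cong f≗g)

words-+ : ∀ m {n} (f : Fin (m + n) → Word) → words f ≡ words (λ i → f (i ↑ˡ n)) ++ words (λ j → f (m ↑ʳ j))
words-+ zero    f = refl
words-+ (suc m) f = trans (cong (f zero ++_) (words-+ m (f ∘ suc))) (sym (++-assoc (f zero) _ _))

words-* : ∀ m {n} (f : Fin (m * n) → Word) → words f ≡ words λ (i : Fin m) → words λ (j : Fin n) → f (combine i j)
words-* zero        f = refl
words-* (suc m) {n} f = trans (words-+ n f) (cong (words (λ i → f (i ↑ˡ m * n)) ++_) (words-* m (λ i → f (n ↑ʳ i))))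

words-absents : ∀ m n → words {m} (λ _ → absents n) ≡ absents (m * n)
words-absents zero    n = refl
words-absents (suc m) n = trans (cong (absents n ++_) (words-absents m n)) (sym (absents-+ n (m * n)))

words-absent : ∀ m → words {m} (λ _ → absent ∷ []) ≡ absents m
words-absent zero    = refl
words-absent (suc m) = cong (absent ∷_) (words-absent m)

concatMap-allFin : ∀ {n} (f : Fin n → Word) {g} → (∀ i → f i ≡ g i) → concatMap f (allFin n) ≡ words g
concatMap-allFin f f≗g = cong concat (trans (map-tabulate (λ i → i) f) (tabulate-cong f≗g))

encodeEntries-tabulate : ∀ {n} (f : Fin n → Entry) → encodeEntries (tabulate f) ≡ words (encodeEntry′ ∘ f)
encodeEntries-tabulate f = cong concat (map-tabulate f encodeEntry′)

entryOf-word : ∀ b (w : T b → ℤ) → encodeEntry b w ≡ encodeEntry′ (entryOf b w)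
entryOf-word true  w = refl
entryOf-word false w = refl

entryOf-value : ∀ e → entryOf (is-just e) (value e) ≡ e
entryOf-value (just _) = refl
entryOf-value nothing  = refl

rowsOf : Game → List Row
rowsOf G = tabulate λ s → owner s , tabulate (weight s)
  where
  open Game G
  open Split G

encodeGame-words : ∀ G → let open Game G; open Split G in
  encodeGame G ≡ words λ s → encodeOwner (owner s) ∷ words λ s′ → encodeEntry′ (weight s s′)
encodeGame-words G = concatMap-allFin _ λ s →
  cong (encodeOwner (Game.owner G s) ∷_) (concatMap-allFin _ λ s′ → entryOf-word (Game.E G s s′) (Game.w G))

encodeGame-rows : ∀ G → encodeGame G ≡ encodeRows (rowsOf G)
encodeGame-rows G = trans (encodeGame-words G) (sym (trans
  (cong concat (map-tabulate (λ s → Game.owner G s , tabulate (Split.weight G s)) encodeRow))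
  (words-cong {Game.size G} λ s →
    cong (encodeOwner (Game.owner G s) ∷_) (encodeEntries-tabulate (Split.weight G s)))))

-- Both kinds of rows contain this pattern: an original state s has its weights in the s-th block of
-- midpoint columns, a midpoint (a , b) has its weight in column b.
block : ∀ {n} → Fin n → Word → Word → Word
block i V W = words λ j → if does (i ≟ j) then W else V

entries-tabulate : ∀ {k n} (o : Fin k → Player) (m : Fin k → Fin n → Entry) →
                   entries (tabulate λ s → o s , tabulate (m s)) ≡ k * n
entries-tabulate {zero}  o m = refl
entries-tabulate {suc k} o m = cong₂ _+_ (length-tabulate (m zero)) (entries-tabulate (o ∘ suc) (m ∘ suc))

-- The number `k` of rows is independent of their width `n` and `j` is arbitrary, because the
-- induction removes a row and adds its width to `j`.
firstRows-tabulate : ∀ {k n} j (o : Fin k → Player) (m : Fin k → Fin n → Entry) →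
  firstRows j (tabulate λ s → o s , tabulate (m s)) ≡
  words λ s → encodeOwner (o s)
    ∷ absents j ++ block s (absents n) (words λ b → encodeEntry′ (doubled (m s b)))
firstRows-tabulate {zero}      j o m = refl
firstRows-tabulate {suc k} {n} j o m = cong (encodeOwner (o zero) ∷_) (begin
  absents j ++ encodeEntries (map doubled (tabulate (m zero))) ++ absents (entries (tabulate rest))
  ++ firstRows (j + length (tabulate (m zero))) (tabulate rest)
    ≡⟨ cong (absents j ++_) (cong₂ _++_
         (trans (cong encodeEntries (map-tabulate (m zero) doubled))
                (encodeEntries-tabulate (doubled ∘ m zero)))
         (cong₂ _++_
           (trans (cong absents (entries-tabulate (o ∘ suc) (m ∘ suc))) (sym (words-absents k n)))
           (trans (cong (λ l → firstRows (j + l) (tabulate rest)) (length-tabulate (m zero)))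
             (trans (firstRows-tabulate (j + n) (o ∘ suc) (m ∘ suc))
               (words-cong λ s → cong (encodeOwner (o (suc s)) ∷_)
                 (trans (cong (_++ block₊ s) (absents-+ j n)) (++-assoc (absents j) (absents n) (block₊ s)))))))) ⟩
  absents j ++ W ++ V ++ R
    ≡⟨ cong (absents j ++_) (++-assoc W V R) ⟨
  absents j ++ (W ++ V) ++ R
    ≡⟨ ++-assoc (absents j) (W ++ V) R ⟨
  (absents j ++ (W ++ V)) ++ R
    ∎)
  where
  open ≡-Reasoning
  rest = λ s → o (suc s) , tabulate (m (suc s))
  block₊ = λ s → block s (absents n) (words λ b → encodeEntry′ (doubled (m (suc s) b)))
  W = words λ b → encodeEntry′ (doubled (m zero b))
  V = words {k} λ _ → absents n
  R = words λ s → encodeOwner (o (suc s)) ∷ absents j ++ absents n ++ block₊ s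

absents-shift : ∀ j w → absents (suc j) ++ w ≡ absents j ++ absent ∷ w
absents-shift zero    w = refl
absents-shift (suc j) w = cong (absent ∷_) (absents-shift j w)

secondRow-tabulate : ∀ {m} k j (f : Fin m → Entry) →
  secondRow k j (tabulate f) ≡
  words λ b → own₁ ∷ absents j ++ block b (absent ∷ []) (encodeℤ (returning (f b))) ++ absents k
secondRow-tabulate {zero}  k j f = refl
secondRow-tabulate {suc m} k j f = cong (own₁ ∷_) (begin
  absents j ++ e ++ absents (length (tabulate (f ∘ suc)) + k) ++ secondRow k (suc j) (tabulate (f ∘ suc))
    ≡⟨ cong (λ x → absents j ++ e ++ x) (cong₂ _++_
         (trans (cong (λ l → absents (l + k)) (length-tabulate (f ∘ suc)))
           (trans (absents-+ m k) (cong (_++ absents k) (sym (words-absent m)))))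
         (trans (secondRow-tabulate k (suc j) (f ∘ suc))
           (words-cong λ b → cong (own₁ ∷_) (absents-shift j
             (block b (absent ∷ []) (encodeℤ (returning (f (suc b)))) ++ absents k))))) ⟩
  absents j ++ e ++ (V ++ absents k) ++ R
    ≡⟨ cong (absents j ++_) (trans (cong (_++ R) (++-assoc e V (absents k))) (++-assoc e (V ++ absents k) R)) ⟨
  absents j ++ ((e ++ V) ++ absents k) ++ R
    ≡⟨ ++-assoc (absents j) ((e ++ V) ++ absents k) R ⟨
  (absents j ++ (e ++ V) ++ absents k) ++ R
    ∎)
  where
  open ≡-Reasoning
  e = encodeℤ (returning (f zero))
  V = words {m} λ _ → absent ∷ []
  R = words λ b → own₁ ∷ absents j
                  ++ (absent ∷ block b (absent ∷ []) (encodeℤ (returning (f (suc b))))) ++ absents k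

module _ (G : Game) where
  open Game G
  open Split G

  encodeKindRow : Kind → Word
  encodeKindRow k = encodeOwner (splitOwner k)
    ∷ words (λ s → encodeEntry′ (splitWeight k (inj₁ s)))
    ++ words (λ a → words λ b → encodeEntry′ (splitWeight k (inj₂ (a , b))))

  words-code : (f : Kind → Word) →
    words (f ∘ kind) ≡ words (λ s → f (inj₁ s)) ++ words λ a → words λ b → f (inj₂ (a , b))
  words-code f = trans (words-+ size (f ∘ kind)) (cong₂ _++_
    (words-cong λ s → cong f (kind-code (inj₁ s)))
    (trans (words-* size _) (words-cong {size} λ a → words-cong {size} λ b → cong f (kind-code (inj₂ (a , b))))))

  encodeGame-split : encodeGame split ≡
    words (λ s → encodeKindRow (inj₁ s)) ++ words λ a → words λ b → encodeKindRow (inj₂ (a , b))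
  encodeGame-split = trans (encodeGame-words split) (trans
    (words-cong λ p → cong (encodeOwner (splitOwner (kind p)) ∷_) (trans
      (words-cong λ q → cong encodeEntry′ (entryOf-value (splitWeight (kind p) (kind q))))
      (words-code (λ k → encodeEntry′ (splitWeight (kind p) k)))))
    (words-code encodeKindRow))

  originalRow : ∀ s → encodeKindRow (inj₁ s) ≡
    encodeOwner (owner s)
    ∷ absents size ++ block s (absents size) (words λ b → encodeEntry′ (doubled (weight s b)))
  originalRow s = cong (encodeOwner (owner s) ∷_) (cong₂ _++_ (words-absent size)
    (words-cong λ a → choose (does (s ≟ a))))
    where
    choose : ∀ c → words (λ b → encodeEntry′ (if c then doubled (weight s b) else nothing)) ≡
                   (if c then words (λ b → encodeEntry′ (doubled (weight s b))) else absents size)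
    choose true  = refl
    choose false = words-absent size

  halfwayRow : ∀ a b → encodeKindRow (inj₂ (a , b)) ≡
    own₁ ∷ block b (absent ∷ []) (encodeℤ (returning (weight a b))) ++ absents (size * size)
  halfwayRow a b = cong (own₁ ∷_) (cong₂ _++_
    (words-cong {size} λ s → if-float encodeEntry′ (does (b ≟ s)))
    (trans (words-cong {size} λ _ → words-absent size) (words-absents size size)))

  rows : List Row
  rows = rowsOf G

  length-rows : length rows ≡ size
  length-rows = length-tabulate _

  rows-uniform : All (λ (_ , es) → length es + size * size ≡ length rows + entries rows) rows
  rows-uniform = All.tabulate⁺ λ s → cong₂ _+_
    (trans (length-tabulate (weight s)) (sym length-rows))
    (sym (entries-tabulate owner weight))

  reduce-rows : ∀ z → reduce (size * size) rows z ≡ encodeGame split ++ sep ∷ z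
  reduce-rows z = begin
    firstRows (length rows) rows ++ secondRows (size * size) rows ++ sep ∷ z
      ≡⟨ cong₂ (λ u v → u ++ v ++ sep ∷ z) first second ⟩
    words (λ s → encodeKindRow (inj₁ s)) ++ words (λ a → words λ b → encodeKindRow (inj₂ (a , b))) ++ sep ∷ z
      ≡⟨ ++-assoc (words λ s → encodeKindRow (inj₁ s)) _ _ ⟨
    (words (λ s → encodeKindRow (inj₁ s)) ++ words (λ a → words λ b → encodeKindRow (inj₂ (a , b)))) ++ sep ∷ z
      ≡⟨ cong (_++ sep ∷ z) encodeGame-split ⟨
    encodeGame split ++ sep ∷ z
      ∎
    where
    open ≡-Reasoning

    first : firstRows (length rows) rows ≡ words λ s → encodeKindRow (inj₁ s)
    first = trans (cong (λ n → firstRows n rows) length-rows)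
      (trans (firstRows-tabulate size owner weight) (words-cong λ s → sym (originalRow s)))

    second : secondRows (size * size) rows ≡ words λ a → words λ b → encodeKindRow (inj₂ (a , b))
    second = trans (cong concat (map-tabulate (λ s → owner s , tabulate (weight s)) _))
      (words-cong {size} λ a →
      trans (secondRow-tabulate (size * size) 0 (weight a)) (words-cong {size} λ b → sym (halfwayRow a b)))

-- The reduction on instances: polynomial time and correctness.

splitInstance : Instance → Instance
splitInstance I = record
  { game      = split
  ; init      = ι init
  ; threshold = threshold
  }
  where
  open Instance I
  open Split game

encode-input : ∀ I → let open Instance I in
  encode I ≡ encodeRows (rowsOf game) ++ sep ∷ replicate (toℕ init) tick ++ sep ∷ encodeℚ threshold
encode-input I = cong (_++ sep ∷ replicate (toℕ init) tick ++ sep ∷ encodeℚ threshold) (encodeGame-rows game)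
  where open Instance I

encode-output : ∀ I → let open Instance I in
  reduce (Game.size game * Game.size game) (rowsOf game)
    (replicate (toℕ init) tick ++ sep ∷ encodeℚ threshold)
  ≡ encode (splitInstance I)
encode-output I = trans (reduce-rows game _)
  (cong (λ i → encodeGame split ++ sep ∷ replicate i tick ++ sep ∷ encodeℚ threshold)
        (sym (toℕ-↑ˡ init (Game.size game * Game.size game))))
  where
  open Instance I
  open Split game

splitInstance-polynomialTime : PolynomialTime encode encode splitInstance
splitInstance-polynomialTime =
  let c , d , bound = polynomial-bound reductionTime-polynomial in record
  { machine = compile reduction
  ; c       = c
  ; d       = d
  ; runs    = λ I → let n , n≤ , halts = runs I in n , ≤-trans n≤ (bound (length (encode I))) , halts
  }
  where
  runs : ∀ I → ∃[ n ] n ≤ reductionTime (length (encode I)) ×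
         HaltsIn (compile reduction) n (initialConfiguration (compile reduction) (encode I))
           (encode (splitInstance I))
  runs I rewrite encode-input I | sym (encode-output I) = reduction-halts _ _ (rows-uniform (Instance.game I))

module _ (G : Game) (s₀ : Game.State G) where
  open Game G
  open Split G

  module _ {σ : Strategy G player₁ s₀} {τ : Strategy G player₂ s₀}
           {σ′ : Strategy split player₁ (ι s₀)} {τ′ : Strategy split player₂ (ι s₀)}
           (σ~ : Corresponding s₀ player₁ σ σ′) (τ~ : Corresponding s₀ player₂ τ τ′) where

    π : Play G s₀
    π = outcome σ τ

    π′ : Play split (ι s₀)
    π′ = outcome σ′ τ′

    open Play

    weight-out : ∀ {s b} (e : T (E s b)) k k′ (x : Edge k k′) → k ≡ inj₁ s → k′ ≡ inj₂ (s , b) →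
                 value (splitWeight k k′) x ≡ w e ℤ.+ w e
    weight-out e _ _ x refl refl = forward-value e x

    weight-back : ∀ {s b} (e : T (E s b)) k k′ (x : Edge k k′) → k ≡ inj₂ (s , b) → k′ ≡ inj₁ b →
                  value (splitWeight k k′) x ≡ ℤ.- (w e ℤ.+ w e)
    weight-back e _ _ x refl refl = backward-value e x

    kind-even : ∀ n → kind (state π′ (n * 2)) ≡ inj₁ (state π n)
    kind-even n = trans (cong kind (cong proj₁ (history-ι s₀ σ~ τ~ n))) (kind-code _)

    kind-odd : ∀ n → kind (state π′ (suc (n * 2))) ≡ inj₂ (state π n , state π (suc n))
    kind-odd n = trans (cong kind (history-κ s₀ σ~ τ~ n)) (kind-code _)

    EL-even : ∀ n → EL π′ (n * 2) ≡ 0ℤ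
    EL-odd  : ∀ n → EL π′ (suc (n * 2)) ≡ w (edge π n) ℤ.+ w (edge π n)

    EL-odd n = trans (cong₂ ℤ._+_ (EL-even n)
      (weight-out (edge π n) _ _ (edge π′ (n * 2)) (kind-even n) (kind-odd n))) (ℤ.+-identityˡ _)

    EL-even zero    = refl
    EL-even (suc n) = trans (cong₂ ℤ._+_ (EL-odd n)
      (weight-back (edge π n) _ _ (edge π′ (suc (n * 2))) (kind-odd n) (kind-even (suc n))))
      (ℤ.+-inverseʳ (w (edge π n) ℤ.+ w (edge π n)))

    -- Levels at even positions contribute 0 and those at odd positions twice a weight, so the
    -- weights add up to the original energy level. The sums at 2n + 1 and 2n + 2 agree, as
    -- `limsup-means` requires.
    sumEL-even : ∀ n → sumEL π′ (n * 2) ≡ EL π n ℤ.+ EL π n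
    sumEL-odd  : ∀ n → sumEL π′ (suc (n * 2)) ≡ EL π (suc n) ℤ.+ EL π (suc n)

    sumEL-odd n = trans (cong₂ ℤ._+_ (sumEL-even n) (EL-odd n))
      (solve 2 (λ x y → (x :+ x) :+ (y :+ y) := (x :+ y) :+ (x :+ y)) refl (EL π n) (w (edge π n)))
      where open ℤSolver.+-*-Solver

    sumEL-even zero    = refl
    sumEL-even (suc n) = trans (cong₂ ℤ._+_ (sumEL-odd n) (EL-even (suc n))) (ℤ.+-identityʳ _)

    mean-payoff⇔average-energy : ∀ t → MeanPayoff t π ⇔ AvgEnergy t π′
    mean-payoff⇔average-energy = limsup-means (EL π) (sumEL π′) sumEL-odd λ n → sumEL-even (suc n)

-- Against an opponent `τ′` of the split game, the lifted strategy does as well as `σ` does against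
-- the dropped `τ′`; the converse exchanges lifting and dropping.
splitInstance-correct : ∀ I → Player₁Wins MeanPayoff I ⇔ Player₁Wins AvgEnergy (splitInstance I)
splitInstance-correct I = mk⇔
  (λ (σ , wins) → lift s₀ σ , λ τ′ →
    to (mean-payoff⇔average-energy G s₀ (lift-corresponding s₀ σ) (drop-corresponding s₀ τ′) t)
      (wins (drop s₀ τ′)))
  (λ (σ′ , wins) → drop s₀ σ′ , λ τ →
    from (mean-payoff⇔average-energy G s₀ (drop-corresponding s₀ σ′) (lift-corresponding s₀ τ) t)
      (wins (lift s₀ τ)))
  where
  open Equivalence
  open Instance I renaming (game to G; init to s₀; threshold to t)
  open Split G

theorem7 : Σ (Instance → Instance) λ f →
    PolynomialTime encode encode f
    × (∀ (I : Instance) → Player₁Wins MeanPayoff I ⇔ Player₁Wins AvgEnergy (f I))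
theorem7 = splitInstance , splitInstance-polynomialTime , splitInstance-correct
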